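{- Let $(v,w)$ be a pair of twins in $\mathbb{Z}^3$ whose common length is an integer. Then there exist a Hurwitz integral quaternion $\alpha$ and an integer $d$ such that the last two columns of $dE(\alpha)$ are either $(v,w)$ or $(-w,v)$. Consequently $(v,w)$ can be extended to a $3$-dimensional icube in $\mathbb{Z}^3$.
   Context: Twins: nonzero orthogonal vectors in $\mathbb{Z}^3$ of equal length. A $3$-dimensional icube in $\mathbb{Z}^3$: three nonzero pairwise orthogonal vectors of equal length. Hurwitz integral quaternions: $a+bi+cj+dk$ with $a,b,c,d$ all integers or all halves of odd integers. For $\alpha=m+ni+pj+qk$, $$E(\alpha)=\begin{pmatrix} m^2+n^2-p^2-q^2 & -2mq+2np & 2mp+2nq\\ 2mq+2np & m^2-n^2+p^2-q^2 & -2mn+2pq\\ -2mp+2nq & 2mn+2pq & m^2-n^2-p^2+q^2\end{pmatrix},$$ whose columns are $\alpha i\overline{\alpha},\alpha j\overline{\alpha},\alpha k\overline{\alpha}$ under the identification of $(v_1,v_2,v_3)$ with $v_1i+v_2j+v_3k$. -}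

module Defs where

open import Data.Integer using (ℤ; +_; _+_; _-_; _*_; -_)
open import Data.Product using (Σ; ∃; _×_; _,_)
open import Data.Sum using (_⊎_)
open import Relation.Binary.PropositionalEquality using (_≡_; _≢_)

record Z3 : Set where
  constructor vec
  field
    x₁ x₂ x₃ : ℤ
open Z3 public

zero3 : Z3
zero3 = vec (+ 0) (+ 0) (+ 0)

infix 6 _·_
_·_ : Z3 → Z3 → ℤ
u · v = x₁ u * x₁ v + x₂ u * x₂ v + x₃ u * x₃ v

infixr 8 _⊛_
_⊛_ : ℤ → Z3 → Z3
c ⊛ v = vec (c * x₁ v) (c * x₂ v) (c * x₃ v)

neg : Z3 → Z3
neg v = vec (- x₁ v) (- x₂ v) (- x₃ v)

Twins : Z3 → Z3 → Set
Twins v w = v ≢ zero3 × w ≢ zero3 × v · w ≡ + 0 × v · v ≡ w · w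

Icube : Z3 → Z3 → Z3 → Set
Icube u v w =
  u ≢ zero3 × v ≢ zero3 × w ≢ zero3 ×
  u · v ≡ + 0 × u · w ≡ + 0 × v · w ≡ + 0 ×
  u · u ≡ v · v × v · v ≡ w · w

Even Odd : ℤ → Set
Even a = ∃ λ t → a ≡ + 2 * t
Odd  a = ∃ λ t → a ≡ + 2 * t + + 1

-- Hurwitz integral quaternion α = (A + B i + C j + D k) / 2, stored via the
-- doubled coordinates A B C D, which are all even (α has integer coordinates)
-- or all odd (α has half-odd-integer coordinates).
record Hurwitz : Set where
  constructor hurwitz
  field
    A B C D : ℤ
    parity : (Even A × Even B × Even C × Even D) ⊎ (Odd A × Odd B × Odd C × Odd D)
open Hurwitz public

-- Columns of 4·E(α): substituting m = A/2, n = B/2, p = C/2, q = D/2 into E(α)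
-- and multiplying by 4 gives the same polynomial expressions in A B C D.
E4col1 E4col2 E4col3 : Hurwitz → Z3
E4col1 α = let m = A α ; n = B α ; p = C α ; q = D α in
  vec (m * m + n * n - p * p - q * q)
      (+ 2 * m * q + + 2 * n * p)
      (- (+ 2 * m * p) + + 2 * n * q)
E4col2 α = let m = A α ; n = B α ; p = C α ; q = D α in
  vec (- (+ 2 * m * q) + + 2 * n * p)
      (m * m - n * n + p * p - q * q)
      (+ 2 * m * n + + 2 * p * q)
E4col3 α = let m = A α ; n = B α ; p = C α ; q = D α in
  vec (+ 2 * m * p + + 2 * n * q)
      (- (+ 2 * m * n) + + 2 * p * q)
      (m * m - n * n - p * p + q * q)

-- "the last two columns of d·E(α) are (a , b)", with denominators cleared:
-- d·E(α) = d·(4E(α))/4, so column j of d·E(α) equals a  iff  d ⊛ E4colj α ≡ 4 ⊛ a.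
LastTwoCols : ℤ → Hurwitz → Z3 → Z3 → Set
LastTwoCols d α a b = d ⊛ E4col2 α ≡ (+ 4) ⊛ a × d ⊛ E4col3 α ≡ (+ 4) ⊛ b

{-# OPTIONS --safe #-}

-- Let L = |v|. The i-th coordinate of v ⨯ w has square L²(L² − vᵢ² − wᵢ²), so L divides it, and
-- u = (v ⨯ w)/L completes v, w to a frame of side L: u ⨯ v = Lw, v ⨯ w = Lu, w ⨯ u = Lv. For the
-- pure quaternions U, V, W this says U² = −L², UV = LW, UW = −LV, and so on, which gives
-- Uβ = Lβi, Vβ = Lβj, Wβ = Lβk for β = Lx − Uxi − Vxj − Wxk. Hence L·βiβ̄ = N(β)U, etc., that is
-- L·E(β) = N(β)·[u v w], and some x ∈ {1, i, j, k} makes β ≠ 0. Dividing β by the gcd of its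
-- coordinates leaves a primitive α = a₀ + a₁i + a₂j + a₃k with L·E(α) = N(α)·[u v w].
-- The matrix G = 4L·ααᵀ/N(α) is integral and linear in L and the entries of [u v w]; with a
-- Bézout vector s (⟨s, α⟩ = 1) this gives 4L = N(α)K for the integer K = sᵀGs, and G = K·ααᵀ.
-- If K is odd, the entries G₀₀ + Gᵢᵢ + 2G₀ᵢ = K(a₀ + aᵢ)² are even, so all coordinates of α are
-- odd and α/2 is a Hurwitz quaternion, with d = K. If 4 ∣ K then α itself works, with d = K/4.
-- If K ≡ 2 (mod 4) then N(α) is even and α(1 − i)/2 is a Hurwitz quaternion, with d = K/2 and
-- last two columns (−w, v).

module Submission where

open import Data.Nat as ℕ using (ℕ; suc)

-- The polynomial operations of the development, over any carrier with ring operations. They are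
-- used at ℤ and at the symbolic polynomials of the ring solver, so that an identity between them
-- is proved by restating it symbolically and normalising (ℤ-identity, Z3-identity, Q-identity).
-- _·_, _⊛_, neg and zero3 repeat Defs; at ℤ they are definitionally the operations of Defs.
module Operations {A V : Set} (vec′ : A → A → A → V) (p₁ p₂ p₃ : V → A)
                  (plus times : A → A → A) (negate : A → A) (κ : ℕ → A) where
  infixl 6 _+_ _-_
  infixl 7 _*_
  infix 8 -_
  _+_ _*_ _-_ : A → A → A
  _+_ = plus
  _*_ = times
  a - b = a + negate b
  -_ : A → A
  -_ = negate

  infix 6 _·_
  _·_ : V → V → A
  u · v = p₁ u * p₁ v + p₂ u * p₂ v + p₃ u * p₃ v

  infixr 8 _⊛_
  _⊛_ : A → V → V
  c ⊛ v = vec′ (c * p₁ v) (c * p₂ v) (c * p₃ v)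

  neg : V → V
  neg v = vec′ (- p₁ v) (- p₂ v) (- p₃ v)

  zero3 : V
  zero3 = vec′ (κ 0) (κ 0) (κ 0)

  infixl 6 _⊞_
  _⊞_ : V → V → V
  a ⊞ b = vec′ (p₁ a + p₁ b) (p₂ a + p₂ b) (p₃ a + p₃ b)

  infixl 7 _⨯_
  _⨯_ : V → V → V
  a ⨯ b = vec′ (p₂ a * p₃ b - p₃ a * p₂ b) (p₃ a * p₁ b - p₁ a * p₃ b) (p₁ a * p₂ b - p₂ a * p₁ b)

  lagrange-term : A → A → A → A → A → A
  lagrange-term X Y Z a b = (X - a * a) * (Y - b * b) - (Z - a * b) * (Z - a * b)

  record Quaternion : Set where
    constructor quat
    field
      re : A
      im : V
  open Quaternion public

  infixl 7 _⊗_
  _⊗_ : Quaternion → Quaternion → Quaternion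
  α ⊗ β = quat (re α * re β - (im α · im β)) (re α ⊛ im β ⊞ re β ⊛ im α ⊞ im α ⨯ im β)

  infixl 6 _⊟_
  _⊟_ : Quaternion → Quaternion → Quaternion
  α ⊟ β = quat (re α - re β) (im α ⊞ neg (im β))

  infixr 8 _⊙_
  _⊙_ : A → Quaternion → Quaternion
  c ⊙ α = quat (c * re α) (c ⊛ im α)

  conj : Quaternion → Quaternion
  conj α = quat (re α) (neg (im α))

  norm : Quaternion → A
  norm α = re α * re α + (im α · im α)

  ⟪_,_⟫ : Quaternion → Quaternion → A
  ⟪ s , α ⟫ = re s * re α + (im s · im α)

  pure : V → Quaternion
  pure = quat (κ 0)

  0q 𝟏 𝐢 𝐣 𝐤 : Quaternion
  0q = quat (κ 0) zero3
  𝟏 = quat (κ 1) zero3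
  𝐢 = pure (vec′ (κ 1) (κ 0) (κ 0))
  𝐣 = pure (vec′ (κ 0) (κ 1) (κ 0))
  𝐤 = pure (vec′ (κ 0) (κ 0) (κ 1))

  -- The columns of E(α); at ℤ they are the columns E4col… of Defs for doubled coordinates.
  E₁ E₂ E₃ : Quaternion → V
  E₁ (quat m w) = let n = p₁ w ; p = p₂ w ; q = p₃ w in
    vec′ (m * m + n * n - p * p - q * q) (κ 2 * m * q + κ 2 * n * p) (- (κ 2 * m * p) + κ 2 * n * q)
  E₂ (quat m w) = let n = p₁ w ; p = p₂ w ; q = p₃ w in
    vec′ (- (κ 2 * m * q) + κ 2 * n * p) (m * m - n * n + p * p - q * q) (κ 2 * m * n + κ 2 * p * q)
  E₃ (quat m w) = let n = p₁ w ; p = p₂ w ; q = p₃ w in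
    vec′ (κ 2 * m * p + κ 2 * n * q) (- (κ 2 * m * n) + κ 2 * p * q) (m * m - n * n - p * p + q * q)

  ijk-combination : A → Quaternion → Quaternion → Quaternion → Quaternion → Quaternion
  ijk-combination L x A B C = L ⊙ x ⊟ A ⊗ 𝐢 ⊟ B ⊗ 𝐣 ⊟ C ⊗ 𝐤

  frame-quaternion : A → V → V → V → Quaternion → Quaternion
  frame-quaternion L u v w x = ijk-combination L x (pure u ⊗ x) (pure v ⊗ x) (pure w ⊗ x)

  -- For c = L and u, v, w the columns of a matrix M this is sᵀGs, where G is the integral matrix
  -- with N(α)·G = 4L·ααᵀ whenever L·E(α) = N(α)·M: the usual recovery of a quaternion from its
  -- rotation matrix.
  form : A → V → V → V → Quaternion → A
  form c u v w s =
    s₀ * s₀ * (c + u₁ + v₂ + w₃) + s₁ * s₁ * (c + u₁ - v₂ - w₃) +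
    s₂ * s₂ * (c - u₁ + v₂ - w₃) + s₃ * s₃ * (c - u₁ - v₂ + w₃) +
    κ 2 * s₀ * s₁ * (v₃ - w₂) + κ 2 * s₀ * s₂ * (w₁ - u₃) + κ 2 * s₀ * s₃ * (u₂ - v₁) +
    κ 2 * s₁ * s₂ * (u₂ + v₁) + κ 2 * s₁ * s₃ * (u₃ + w₁) + κ 2 * s₂ * s₃ * (v₃ + w₂)
    where
    u₁ u₂ u₃ v₁ v₂ v₃ w₁ w₂ w₃ s₀ s₁ s₂ s₃ : A
    u₁ = p₁ u ; u₂ = p₂ u ; u₃ = p₃ u
    v₁ = p₁ v ; v₂ = p₂ v ; v₃ = p₃ v
    w₁ = p₁ w ; w₂ = p₂ w ; w₃ = p₃ w
    s₀ = re s ; s₁ = p₁ (im s) ; s₂ = p₂ (im s) ; s₃ = p₃ (im s)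

open import Defs
open import Data.Integer using (ℤ; +_; -[1+_]; _+_; _-_; -_; _*_; 0ℤ; ∣_∣; _≟_; ≢-nonZero)
import Data.Integer.Properties as ℤ
open import Data.Integer.Divisibility.Signed using (_∣_; divides; ∣-trans; ∣ᵤ⇒∣)
open import Data.Integer.DivMod using (_%ℕ_; _/ℕ_; n%ℕd<d; a≡a%ℕn+[a/ℕn]*n)
import Data.Integer.Tactic.RingSolver as ℤ-Solver
open import Tactic.RingSolver.NonReflective ℤ-Solver.ring
  using (Expr; Κ; Ι; module Ops) renaming (_⊕_ to _⊕ᴱ_; _⊗_ to _⊗ᴱ_; ⊝_ to ⊝ᴱ_)
import Data.Nat.Properties as ℕ
import Data.Nat.Divisibility as ℕ
open import Data.Nat.DivMod using (m/n*n≡m)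
import Data.Nat.Tactic.RingSolver as ℕ-Solver
open import Data.Nat.GCD using (gcd[m,n]∣m; gcd[m,n]∣n; gcd[m,n]≡0⇒n≡0; module GCD)
  renaming (gcd to gcdℕ; module Bézout to ℕ-Bézout)
open import Data.Nat.Coprimality using (coprime-/gcd; coprime-divisor)
import Data.Nat.Coprimality as Coprime
open import Data.Fin using (#_)
open import Data.Vec using (Vec; []; _∷_)
open import Data.Product using (∃; _×_; _,_; proj₁; proj₂)
open import Data.Sum using (_⊎_; inj₁; inj₂)
open import Data.Empty using (⊥; ⊥-elim)
open import Relation.Nullary using (yes; no)
open import Relation.Nullary.Decidable using (True)
open import Relation.Binary.PropositionalEquality
open ≡-Reasoning

open Operations vec x₁ x₂ x₃ _+_ _*_ -_ +_ public
  hiding (_+_; _*_; _-_; -_; _·_; _⊛_; neg; zero3) renaming (Quaternion to Q)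

record Z3ᴱ (n : ℕ) : Set where
  constructor vecᴱ
  field y₁ y₂ y₃ : Expr ℤ n
open Z3ᴱ

module S {n : ℕ} = Operations (vecᴱ {n}) y₁ y₂ y₃ _⊕ᴱ_ _⊗ᴱ_ ⊝ᴱ_ (λ k → Κ (+ k))

var : ∀ {n} m {m<n : True (m ℕ.<? n)} → Expr ℤ n
var m {m<n} = Ι (#_ m {m<n = m<n})

quatᴱ : ∀ {n} → Expr ℤ n → Expr ℤ n → Expr ℤ n → Expr ℤ n → S.Quaternion {n}
quatᴱ a b c d = S.quat a (vecᴱ b c d)

⟦_⟧ᵛ : ∀ {n} → Z3ᴱ n → Vec ℤ n → Z3
⟦ a ⟧ᵛ ρ = vec (Ops.⟦ y₁ a ⟧ ρ) (Ops.⟦ y₂ a ⟧ ρ) (Ops.⟦ y₃ a ⟧ ρ)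

⟦_⟧ᵠ : ∀ {n} → S.Quaternion {n} → Vec ℤ n → Q
⟦ α ⟧ᵠ ρ = quat (Ops.⟦ S.re α ⟧ ρ) (⟦ S.im α ⟧ᵛ ρ)

cong₃ : ∀ {A B C D : Set} (f : A → B → C → D) {a a′ b b′ c c′} →
        a ≡ a′ → b ≡ b′ → c ≡ c′ → f a b c ≡ f a′ b′ c′
cong₃ f refl refl refl = refl

-- In these, ρ lists the integer variables of the identity and var i stands for its i-th entry;
-- each refl asks the solver's normal forms of the two sides to agree.
ℤ-identity : ∀ {n} (ρ : Vec ℤ n) l r → Ops.⟦ l ⇓⟧ ρ ≡ Ops.⟦ r ⇓⟧ ρ → Ops.⟦ l ⟧ ρ ≡ Ops.⟦ r ⟧ ρ
ℤ-identity = Ops.prove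

Z3-identity : ∀ {n} (ρ : Vec ℤ n) l r →
  Ops.⟦ y₁ l ⇓⟧ ρ ≡ Ops.⟦ y₁ r ⇓⟧ ρ → Ops.⟦ y₂ l ⇓⟧ ρ ≡ Ops.⟦ y₂ r ⇓⟧ ρ → Ops.⟦ y₃ l ⇓⟧ ρ ≡ Ops.⟦ y₃ r ⇓⟧ ρ →
  ⟦ l ⟧ᵛ ρ ≡ ⟦ r ⟧ᵛ ρ
Z3-identity ρ l r e₁ e₂ e₃ =
  cong₃ vec (ℤ-identity ρ (y₁ l) (y₁ r) e₁) (ℤ-identity ρ (y₂ l) (y₂ r) e₂) (ℤ-identity ρ (y₃ l) (y₃ r) e₃)

Q-identity : ∀ {n} (ρ : Vec ℤ n) l r →
  Ops.⟦ S.re l ⇓⟧ ρ ≡ Ops.⟦ S.re r ⇓⟧ ρ → Ops.⟦ y₁ (S.im l) ⇓⟧ ρ ≡ Ops.⟦ y₁ (S.im r) ⇓⟧ ρ →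
  Ops.⟦ y₂ (S.im l) ⇓⟧ ρ ≡ Ops.⟦ y₂ (S.im r) ⇓⟧ ρ → Ops.⟦ y₃ (S.im l) ⇓⟧ ρ ≡ Ops.⟦ y₃ (S.im r) ⇓⟧ ρ →
  ⟦ l ⟧ᵠ ρ ≡ ⟦ r ⟧ᵠ ρ
Q-identity ρ l r e₀ e₁ e₂ e₃ =
  cong₂ quat (ℤ-identity ρ (S.re l) (S.re r) e₀) (Z3-identity ρ (S.im l) (S.im r) e₁ e₂ e₃)

*-cancelˡ : ∀ {k a b} → k ≢ 0ℤ → k * a ≡ k * b → a ≡ b
*-cancelˡ {k} {a} {b} k≢0 = ℤ.*-cancelˡ-≡ k a b {{≢-nonZero k≢0}}

i≢0⇒i*i≢0 : ∀ {i} → i ≢ 0ℤ → i * i ≢ 0ℤ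
i≢0⇒i*i≢0 {i} i≢0 i*i≡0 with ℤ.i*j≡0⇒i≡0∨j≡0 i i*i≡0
... | inj₁ i≡0 = i≢0 i≡0
... | inj₂ i≡0 = i≢0 i≡0

i*i≡+∣i∣*∣i∣ : ∀ i → i * i ≡ + (∣ i ∣ ℕ.* ∣ i ∣)
i*i≡+∣i∣*∣i∣ (+ n) = sym (ℤ.pos-* n n)
i*i≡+∣i∣*∣i∣ -[1+ n ] = refl

∣i∣*∣i∣≡0⇒i≡0 : ∀ i → ∣ i ∣ ℕ.* ∣ i ∣ ≡ 0 → i ≡ 0ℤ
∣i∣*∣i∣≡0⇒i≡0 i eq with ℕ.m*n≡0⇒m≡0∨n≡0 ∣ i ∣ eq
... | inj₁ ∣i∣≡0 = ℤ.∣i∣≡0⇒i≡0 ∣i∣≡0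
... | inj₂ ∣i∣≡0 = ℤ.∣i∣≡0⇒i≡0 ∣i∣≡0

m*m≡n*n*k⇒n∣m : ∀ {m n k} → n ≢ 0 → m ℕ.* m ≡ n ℕ.* n ℕ.* k → n ℕ.∣ m
m*m≡n*n*k⇒n∣m {m} {n} {k} n≢0 m²≡n²k = subst (ℕ._∣ m) g≡n (gcd[m,n]∣m m n)
  where
  g : ℕ
  g = gcdℕ m n
  instance
    g≢0 : ℕ.NonZero g
    g≢0 = ℕ.≢-nonZero (λ g≡0 → n≢0 (gcd[m,n]≡0⇒n≡0 m g≡0))
  m′ n′ : ℕ
  m′ = m ℕ./ g
  n′ = n ℕ./ g
  m′g≡m : m′ ℕ.* g ≡ m
  m′g≡m = m/n*n≡m (gcd[m,n]∣m m n)
  n′g≡n : n′ ℕ.* g ≡ n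
  n′g≡n = m/n*n≡m (gcd[m,n]∣n m n)
  regroup : ∀ a b c → a ℕ.* b ℕ.* (a ℕ.* b) ℕ.* c ≡ a ℕ.* (a ℕ.* c) ℕ.* (b ℕ.* b)
  regroup = ℕ-Solver.solve-∀
  m′²≡n′[n′k] : m′ ℕ.* m′ ≡ n′ ℕ.* (n′ ℕ.* k)
  m′²≡n′[n′k] = ℕ.*-cancelʳ-≡ _ _ (g ℕ.* g) {{ℕ.m*n≢0 g g}} (begin
    m′ ℕ.* m′ ℕ.* (g ℕ.* g)           ≡⟨ ℕ.[m*n]*[o*p]≡[m*o]*[n*p] m′ m′ g g ⟩
    m′ ℕ.* g ℕ.* (m′ ℕ.* g)           ≡⟨ cong₂ ℕ._*_ m′g≡m m′g≡m ⟩
    m ℕ.* m                           ≡⟨ m²≡n²k ⟩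
    n ℕ.* n ℕ.* k                     ≡⟨ cong (λ x → x ℕ.* x ℕ.* k) n′g≡n ⟨
    n′ ℕ.* g ℕ.* (n′ ℕ.* g) ℕ.* k     ≡⟨ regroup n′ g k ⟩
    n′ ℕ.* (n′ ℕ.* k) ℕ.* (g ℕ.* g)   ∎)
  n′≡1 : n′ ≡ 1
  n′≡1 = coprime-/gcd m n (coprime-divisor (Coprime.sym (coprime-/gcd m n))
           (ℕ.divides (n′ ℕ.* k) (trans m′²≡n′[n′k] (ℕ.*-comm n′ _))) , ℕ.∣-refl)
  g≡n : g ≡ n
  g≡n = begin
    g          ≡⟨ ℕ.*-identityˡ g ⟨
    1 ℕ.* g    ≡⟨ cong (ℕ._* g) n′≡1 ⟨
    n′ ℕ.* g   ≡⟨ n′g≡n ⟩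
    n          ∎

i*i≡j*j*k⇒j∣i : ∀ {i j k} → j ≢ 0ℤ → i * i ≡ j * j * k → j ∣ i
i*i≡j*j*k⇒j∣i {i} {j} {k} j≢0 i²≡j²k = ∣ᵤ⇒∣ (m*m≡n*n*k⇒n∣m ∣j∣≢0 ∣i∣²≡∣j∣²∣k∣)
  where
  ∣j∣≢0 : ∣ j ∣ ≢ 0
  ∣j∣≢0 ∣j∣≡0 = j≢0 (ℤ.∣i∣≡0⇒i≡0 ∣j∣≡0)
  ∣i∣²≡∣j∣²∣k∣ : ∣ i ∣ ℕ.* ∣ i ∣ ≡ ∣ j ∣ ℕ.* ∣ j ∣ ℕ.* ∣ k ∣
  ∣i∣²≡∣j∣²∣k∣ = begin
    ∣ i ∣ ℕ.* ∣ i ∣              ≡⟨ ℤ.abs-* i i ⟨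
    ∣ i * i ∣                     ≡⟨ cong ∣_∣ i²≡j²k ⟩
    ∣ j * j * k ∣                 ≡⟨ ℤ.abs-* (j * j) k ⟩
    ∣ j * j ∣ ℕ.* ∣ k ∣           ≡⟨ cong (ℕ._* ∣ k ∣) (ℤ.abs-* j j) ⟩
    ∣ j ∣ ℕ.* ∣ j ∣ ℕ.* ∣ k ∣     ∎

record Bézout (a b : ℤ) : Set where
  field
    gcd : ℤ
    gcd∣a : gcd ∣ a
    gcd∣b : gcd ∣ b
    x y : ℤ
    identity : x * a + y * b ≡ gcd

+∣i∣≡sign*i : ∀ i → ∃ λ σ → + ∣ i ∣ ≡ σ * i
+∣i∣≡sign*i i with ℤ.+∣i∣≡i⊎+∣i∣≡-i i
... | inj₁ ∣i∣≡i  = + 1 , trans ∣i∣≡i (sym (ℤ.*-identityˡ i))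
... | inj₂ ∣i∣≡-i = - + 1 , trans ∣i∣≡-i (sym (ℤ.-1*i≡-i i))

bézout-from-ℕ : ∀ d x y {m n} σ τ a b → d + y * n ≡ x * m → m ≡ σ * a → n ≡ τ * b →
                (x * σ) * a + (- y * τ) * b ≡ d
bézout-from-ℕ d x y {m} {n} σ τ a b eq m≡σa n≡τb = begin
  (x * σ) * a + (- y * τ) * b  ≡⟨ regroup x σ a y τ b ⟩
  x * (σ * a) - y * (τ * b)    ≡⟨ cong₂ (λ p q → x * p - y * q) m≡σa n≡τb ⟨
  x * m - y * n                ≡⟨ cong (_- y * n) eq ⟨
  d + y * n - y * n            ≡⟨ cancel d (y * n) ⟩
  d                            ∎
  where
  regroup : ∀ x σ a y τ b → (x * σ) * a + (- y * τ) * b ≡ x * (σ * a) - y * (τ * b)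
  regroup = ℤ-Solver.solve-∀
  cancel : ∀ d t → d + t - t ≡ d
  cancel = ℤ-Solver.solve-∀

bézout : ∀ a b → Bézout a b
bézout a b with ℕ-Bézout.lemma ∣ a ∣ ∣ b ∣ | +∣i∣≡sign*i a | +∣i∣≡sign*i b
... | ℕ-Bézout.result d g identity | σ , ∣a∣≡σa | τ , ∣b∣≡τb = record
  { gcd = + d
  ; gcd∣a = ∣ᵤ⇒∣ {+ d} {a} (GCD.gcd∣m g)
  ; gcd∣b = ∣ᵤ⇒∣ {+ d} {b} (GCD.gcd∣n g)
  ; x = proj₁ (coefficients identity)
  ; y = proj₁ (proj₂ (coefficients identity))
  ; identity = proj₂ (proj₂ (coefficients identity))
  }
  where
  cast : ∀ d′ x′ y′ m′ n′ → d′ ℕ.+ y′ ℕ.* n′ ≡ x′ ℕ.* m′ → + d′ + + y′ * + n′ ≡ + x′ * + m′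
  cast d′ x′ y′ m′ n′ eq = begin
    + d′ + + y′ * + n′      ≡⟨ cong (λ t → + d′ + t) (ℤ.pos-* y′ n′) ⟨
    + d′ + + (y′ ℕ.* n′)    ≡⟨ ℤ.pos-+ d′ (y′ ℕ.* n′) ⟨
    + (d′ ℕ.+ y′ ℕ.* n′)    ≡⟨ cong +_ eq ⟩
    + (x′ ℕ.* m′)           ≡⟨ ℤ.pos-* x′ m′ ⟩
    + x′ * + m′             ∎
  coefficients : ℕ-Bézout.Identity d ∣ a ∣ ∣ b ∣ → ∃ λ x → ∃ λ y → x * a + y * b ≡ + d
  coefficients (ℕ-Bézout.+- x y eq) =
    + x * σ , - + y * τ , bézout-from-ℕ (+ d) (+ x) (+ y) σ τ a b (cast d x y _ _ eq) ∣a∣≡σa ∣b∣≡τb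
  coefficients (ℕ-Bézout.-+ x y eq) =
    - + x * σ , + y * τ , trans (ℤ.+-comm (- + x * σ * a) (+ y * τ * b))
      (bézout-from-ℕ (+ d) (+ y) (+ x) τ σ b a (cast d y x _ _ eq) ∣b∣≡τb ∣a∣≡σa)

even⊎odd : ∀ a → Even a ⊎ Odd a
even⊎odd a with a %ℕ 2 | a /ℕ 2 | n%ℕd<d a 2 | a≡a%ℕn+[a/ℕn]*n a 2
... | 0 | q | _ | a≡0+q2 = inj₁ (q , trans a≡0+q2 (0+q2≡2q q))
  where
  0+q2≡2q : ∀ q → + 0 + q * + 2 ≡ + 2 * q
  0+q2≡2q = ℤ-Solver.solve-∀
... | 1 | q | _ | a≡1+q2 = inj₂ (q , trans a≡1+q2 (1+q2≡2q+1 q))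
  where
  1+q2≡2q+1 : ∀ q → + 1 + q * + 2 ≡ + 2 * q + + 1
  1+q2≡2q+1 = ℤ-Solver.solve-∀
... | suc (suc _) | _ | ℕ.s≤s (ℕ.s≤s ()) | _

even∧odd⇒⊥ : ∀ {a} → Even a → Odd a → ⊥
even∧odd⇒⊥ {a} (t , a≡2t) (r , a≡2r+1) with ℕ.m*n≡1⇒m≡1 2 ∣ t - r ∣ 2∣t-r∣≡1
  where
  2[t-r]≡1 : + 2 * (t - r) ≡ + 1
  2[t-r]≡1 = begin
    + 2 * (t - r)            ≡⟨ distrib t r ⟩
    + 2 * t - + 2 * r        ≡⟨ cong (_- + 2 * r) (trans (sym a≡2t) a≡2r+1) ⟩
    + 2 * r + + 1 - + 2 * r  ≡⟨ cancel (+ 2 * r) ⟩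
    + 1                      ∎
    where
    distrib : ∀ t r → + 2 * (t - r) ≡ + 2 * t - + 2 * r
    distrib = ℤ-Solver.solve-∀
    cancel : ∀ x → x + + 1 - x ≡ + 1
    cancel = ℤ-Solver.solve-∀
  2∣t-r∣≡1 : 2 ℕ.* ∣ t - r ∣ ≡ 1
  2∣t-r∣≡1 = trans (sym (ℤ.abs-* (+ 2) (t - r))) (cong ∣_∣ 2[t-r]≡1)
... | ()

odd*m-even⇒m-even : ∀ {k m} → Odd k → Even (k * m) → Even m
odd*m-even⇒m-even {k} {m} (j , k≡2j+1) km-even with even⊎odd m
... | inj₁ m-even = m-even
... | inj₂ (r , m≡2r+1) = ⊥-elim (even∧odd⇒⊥ km-even (+ 2 * j * r + j + r , (begin
  k * m                               ≡⟨ cong₂ _*_ k≡2j+1 m≡2r+1 ⟩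
  (+ 2 * j + + 1) * (+ 2 * r + + 1)   ≡⟨ expand j r ⟩
  + 2 * (+ 2 * j * r + j + r) + + 1   ∎)))
  where
  expand : ∀ j r → (+ 2 * j + + 1) * (+ 2 * r + + 1) ≡ + 2 * (+ 2 * j * r + j + r) + + 1
  expand = ℤ-Solver.solve-∀

m*m-even⇒m-even : ∀ {m} → Even (m * m) → Even m
m*m-even⇒m-even {m} m²-even with even⊎odd m
... | inj₁ m-even = m-even
... | inj₂ m-odd = odd*m-even⇒m-even m-odd m²-even

b≡[a+b]-a : ∀ a b → b ≡ (a + b) - a
b≡[a+b]-a = ℤ-Solver.solve-∀

a+b-even∧a-even⇒b-even : ∀ {a b} → Even (a + b) → Even a → Even b
a+b-even∧a-even⇒b-even {a} {b} (t , a+b≡2t) (r , a≡2r) = t - r , (begin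
  b                   ≡⟨ b≡[a+b]-a a b ⟩
  (a + b) - a         ≡⟨ cong₂ _-_ a+b≡2t a≡2r ⟩
  + 2 * t - + 2 * r   ≡⟨ factor t r ⟩
  + 2 * (t - r)       ∎)
  where
  factor : ∀ t r → + 2 * t - + 2 * r ≡ + 2 * (t - r)
  factor = ℤ-Solver.solve-∀

a+b-even∧a-odd⇒b-odd : ∀ {a b} → Even (a + b) → Odd a → Odd b
a+b-even∧a-odd⇒b-odd {a} {b} (t , a+b≡2t) (r , a≡2r+1) = t - r - + 1 , (begin
  b                            ≡⟨ b≡[a+b]-a a b ⟩
  (a + b) - a                  ≡⟨ cong₂ _-_ a+b≡2t a≡2r+1 ⟩
  + 2 * t - (+ 2 * r + + 1)    ≡⟨ factor t r ⟩
  + 2 * (t - r - + 1) + + 1    ∎)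
  where
  factor : ∀ t r → + 2 * t - (+ 2 * r + + 1) ≡ + 2 * (t - r - + 1) + + 1
  factor = ℤ-Solver.solve-∀

·-comm : ∀ a b → a · b ≡ b · a
·-comm (vec a₁ a₂ a₃) (vec b₁ b₂ b₃) =
  cong₃ (λ x y z → x + y + z) (ℤ.*-comm a₁ b₁) (ℤ.*-comm a₂ b₂) (ℤ.*-comm a₃ b₃)

⊛-assoc : ∀ a b v → (a * b) ⊛ v ≡ a ⊛ (b ⊛ v)
⊛-assoc a b (vec v₁ v₂ v₃) = cong₃ vec (ℤ.*-assoc a b v₁) (ℤ.*-assoc a b v₂) (ℤ.*-assoc a b v₃)

⊛-comm : ∀ a b v → a ⊛ (b ⊛ v) ≡ b ⊛ (a ⊛ v)
⊛-comm a b v = trans (sym (⊛-assoc a b v)) (trans (cong (_⊛ v) (ℤ.*-comm a b)) (⊛-assoc b a v))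

neg-⊛ : ∀ k a → neg (k ⊛ a) ≡ (- k) ⊛ a
neg-⊛ k (vec a₁ a₂ a₃) = cong₃ vec (ℤ.neg-distribˡ-* k a₁) (ℤ.neg-distribˡ-* k a₂) (ℤ.neg-distribˡ-* k a₃)

⊛-cancelˡ : ∀ {k a b} → k ≢ 0ℤ → k ⊛ a ≡ k ⊛ b → a ≡ b
⊛-cancelˡ {a = vec _ _ _} {vec _ _ _} k≢0 eq =
  cong₃ vec (*-cancelˡ k≢0 (cong x₁ eq)) (*-cancelˡ k≢0 (cong x₂ eq)) (*-cancelˡ k≢0 (cong x₃ eq))

⊛-· : ∀ k a b → (k ⊛ a) · b ≡ k * (a · b)
⊛-· k (vec a₁ a₂ a₃) (vec b₁ b₂ b₃) =
  ℤ-identity (k ∷ a₁ ∷ a₂ ∷ a₃ ∷ b₁ ∷ b₂ ∷ b₃ ∷ []) ((var 0 S.⊛ a) S.· b) (var 0 ⊗ᴱ (a S.· b)) refl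
  where
  a b : Z3ᴱ 7
  a = vecᴱ (var 1) (var 2) (var 3)
  b = vecᴱ (var 4) (var 5) (var 6)

⊛-·-⊛ : ∀ k a → (k ⊛ a) · (k ⊛ a) ≡ k * k * (a · a)
⊛-·-⊛ k (vec a₁ a₂ a₃) =
  ℤ-identity (k ∷ a₁ ∷ a₂ ∷ a₃ ∷ []) ((var 0 S.⊛ a) S.· (var 0 S.⊛ a)) (var 0 ⊗ᴱ var 0 ⊗ᴱ (a S.· a)) refl
  where
  a : Z3ᴱ 4
  a = vecᴱ (var 1) (var 2) (var 3)

⊛-⨯ : ∀ k a b → (k ⊛ a) ⨯ b ≡ k ⊛ (a ⨯ b)
⊛-⨯ k (vec a₁ a₂ a₃) (vec b₁ b₂ b₃) =
  Z3-identity (k ∷ a₁ ∷ a₂ ∷ a₃ ∷ b₁ ∷ b₂ ∷ b₃ ∷ []) ((var 0 S.⊛ a) S.⨯ b) (var 0 S.⊛ (a S.⨯ b)) refl refl refl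
  where
  a b : Z3ᴱ 7
  a = vecᴱ (var 1) (var 2) (var 3)
  b = vecᴱ (var 4) (var 5) (var 6)

⨯-⊛ : ∀ k a b → a ⨯ (k ⊛ b) ≡ k ⊛ (a ⨯ b)
⨯-⊛ k (vec a₁ a₂ a₃) (vec b₁ b₂ b₃) =
  Z3-identity (k ∷ a₁ ∷ a₂ ∷ a₃ ∷ b₁ ∷ b₂ ∷ b₃ ∷ []) (a S.⨯ (var 0 S.⊛ b)) (var 0 S.⊛ (a S.⨯ b)) refl refl refl
  where
  a b : Z3ᴱ 7
  a = vecᴱ (var 1) (var 2) (var 3)
  b = vecᴱ (var 4) (var 5) (var 6)

⨯-anticomm : ∀ a b → b ⨯ a ≡ neg (a ⨯ b)
⨯-anticomm (vec a₁ a₂ a₃) (vec b₁ b₂ b₃) =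
  Z3-identity (a₁ ∷ a₂ ∷ a₃ ∷ b₁ ∷ b₂ ∷ b₃ ∷ []) (b S.⨯ a) (S.neg (a S.⨯ b)) refl refl refl
  where
  a b : Z3ᴱ 6
  a = vecᴱ (var 0) (var 1) (var 2)
  b = vecᴱ (var 3) (var 4) (var 5)

a⨯b≡kc⇒b⨯a≡-kc : ∀ a b k c → a ⨯ b ≡ k ⊛ c → b ⨯ a ≡ (- k) ⊛ c
a⨯b≡kc⇒b⨯a≡-kc a b k c a⨯b≡kc = begin
  b ⨯ a          ≡⟨ ⨯-anticomm a b ⟩
  neg (a ⨯ b)    ≡⟨ cong neg a⨯b≡kc ⟩
  neg (k ⊛ c)    ≡⟨ neg-⊛ k c ⟩
  (- k) ⊛ c      ∎

a⨯a≡0 : ∀ a → a ⨯ a ≡ zero3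
a⨯a≡0 (vec a₁ a₂ a₃) = Z3-identity (a₁ ∷ a₂ ∷ a₃ ∷ []) (a S.⨯ a) S.zero3 refl refl refl
  where
  a : Z3ᴱ 3
  a = vecᴱ (var 0) (var 1) (var 2)

[a⨯b]·a≡0 : ∀ a b → (a ⨯ b) · a ≡ 0ℤ
[a⨯b]·a≡0 (vec a₁ a₂ a₃) (vec b₁ b₂ b₃) =
  ℤ-identity (a₁ ∷ a₂ ∷ a₃ ∷ b₁ ∷ b₂ ∷ b₃ ∷ []) ((a S.⨯ b) S.· a) (Κ 0ℤ) refl
  where
  a b : Z3ᴱ 6
  a = vecᴱ (var 0) (var 1) (var 2)
  b = vecᴱ (var 3) (var 4) (var 5)

[a⨯b]·b≡0 : ∀ a b → (a ⨯ b) · b ≡ 0ℤ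
[a⨯b]·b≡0 (vec a₁ a₂ a₃) (vec b₁ b₂ b₃) =
  ℤ-identity (a₁ ∷ a₂ ∷ a₃ ∷ b₁ ∷ b₂ ∷ b₃ ∷ []) ((a S.⨯ b) S.· b) (Κ 0ℤ) refl
  where
  a b : Z3ᴱ 6
  a = vecᴱ (var 0) (var 1) (var 2)
  b = vecᴱ (var 3) (var 4) (var 5)

lagrange-identity : ∀ a b → (a ⨯ b) · (a ⨯ b) ≡ (a · a) * (b · b) - (a · b) * (a · b)
lagrange-identity (vec a₁ a₂ a₃) (vec b₁ b₂ b₃) =
  ℤ-identity (a₁ ∷ a₂ ∷ a₃ ∷ b₁ ∷ b₂ ∷ b₃ ∷ [])
    ((a S.⨯ b) S.· (a S.⨯ b)) ((a S.· a) ⊗ᴱ (b S.· b) ⊕ᴱ ⊝ᴱ ((a S.· b) ⊗ᴱ (a S.· b))) refl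
  where
  a b : Z3ᴱ 6
  a = vecᴱ (var 0) (var 1) (var 2)
  b = vecᴱ (var 3) (var 4) (var 5)

lagrange-components : ∀ a b → let c = a ⨯ b ; X = a · a ; Y = b · b ; Z = a · b in
  x₁ c * x₁ c ≡ lagrange-term X Y Z (x₁ a) (x₁ b) ×
  x₂ c * x₂ c ≡ lagrange-term X Y Z (x₂ a) (x₂ b) ×
  x₃ c * x₃ c ≡ lagrange-term X Y Z (x₃ a) (x₃ b)
lagrange-components (vec a₁ a₂ a₃) (vec b₁ b₂ b₃) = component y₁ refl , component y₂ refl , component y₃ refl
  where
  ρ : Vec ℤ 6
  ρ = a₁ ∷ a₂ ∷ a₃ ∷ b₁ ∷ b₂ ∷ b₃ ∷ []
  a b : Z3ᴱ 6
  a = vecᴱ (var 0) (var 1) (var 2)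
  b = vecᴱ (var 3) (var 4) (var 5)
  component : ∀ (y : Z3ᴱ 6 → Expr ℤ 6) → Ops.⟦ y (a S.⨯ b) ⊗ᴱ y (a S.⨯ b) ⇓⟧ ρ ≡
    Ops.⟦ S.lagrange-term (a S.· a) (b S.· b) (a S.· b) (y a) (y b) ⇓⟧ ρ →
    Ops.⟦ y (a S.⨯ b) ⊗ᴱ y (a S.⨯ b) ⟧ ρ ≡ Ops.⟦ S.lagrange-term (a S.· a) (b S.· b) (a S.· b) (y a) (y b) ⟧ ρ
  component y = ℤ-identity ρ (y (a S.⨯ b) ⊗ᴱ y (a S.⨯ b)) (S.lagrange-term (a S.· a) (b S.· b) (a S.· b) (y a) (y b))

⨯-⨯ʳ : ∀ a b c → a ⨯ (b ⨯ c) ≡ (a · c) ⊛ b ⊞ (- (a · b)) ⊛ c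
⨯-⨯ʳ (vec a₁ a₂ a₃) (vec b₁ b₂ b₃) (vec c₁ c₂ c₃) =
  Z3-identity (a₁ ∷ a₂ ∷ a₃ ∷ b₁ ∷ b₂ ∷ b₃ ∷ c₁ ∷ c₂ ∷ c₃ ∷ [])
    (a S.⨯ (b S.⨯ c)) ((a S.· c) S.⊛ b S.⊞ (⊝ᴱ (a S.· b)) S.⊛ c) refl refl refl
  where
  a b c : Z3ᴱ 9
  a = vecᴱ (var 0) (var 1) (var 2)
  b = vecᴱ (var 3) (var 4) (var 5)
  c = vecᴱ (var 6) (var 7) (var 8)

⨯-⨯ˡ : ∀ a b c → (a ⨯ b) ⨯ c ≡ (a · c) ⊛ b ⊞ (- (b · c)) ⊛ a
⨯-⨯ˡ (vec a₁ a₂ a₃) (vec b₁ b₂ b₃) (vec c₁ c₂ c₃) =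
  Z3-identity (a₁ ∷ a₂ ∷ a₃ ∷ b₁ ∷ b₂ ∷ b₃ ∷ c₁ ∷ c₂ ∷ c₃ ∷ [])
    ((a S.⨯ b) S.⨯ c) ((a S.· c) S.⊛ b S.⊞ (⊝ᴱ (b S.· c)) S.⊛ a) refl refl refl
  where
  a b c : Z3ᴱ 9
  a = vecᴱ (var 0) (var 1) (var 2)
  b = vecᴱ (var 3) (var 4) (var 5)
  c = vecᴱ (var 6) (var 7) (var 8)

v·v≡0⇒v≡0 : ∀ v → v · v ≡ 0ℤ → v ≡ zero3
v·v≡0⇒v≡0 (vec a b c) v·v≡0 = cong₃ vec (∣i∣*∣i∣≡0⇒i≡0 a a²≡0) (∣i∣*∣i∣≡0⇒i≡0 b b²≡0) (∣i∣*∣i∣≡0⇒i≡0 c c²≡0)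
  where
  a² b² c² : ℕ
  a² = ∣ a ∣ ℕ.* ∣ a ∣
  b² = ∣ b ∣ ℕ.* ∣ b ∣
  c² = ∣ c ∣ ℕ.* ∣ c ∣
  a²+b²+c²≡0 : a² ℕ.+ b² ℕ.+ c² ≡ 0
  a²+b²+c²≡0 = ℤ.+-injective (begin
    + (a² ℕ.+ b² ℕ.+ c²)    ≡⟨ ℤ.pos-+ (a² ℕ.+ b²) c² ⟩
    + (a² ℕ.+ b²) + + c²    ≡⟨ cong (_+ + c²) (ℤ.pos-+ a² b²) ⟩
    + a² + + b² + + c²      ≡⟨ cong₃ (λ x y z → x + y + z) (i*i≡+∣i∣*∣i∣ a) (i*i≡+∣i∣*∣i∣ b) (i*i≡+∣i∣*∣i∣ c) ⟨
    a * a + b * b + c * c   ≡⟨ v·v≡0 ⟩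
    0ℤ                      ∎)
  a²≡0 : a² ≡ 0
  a²≡0 = ℕ.m+n≡0⇒m≡0 a² (ℕ.m+n≡0⇒m≡0 (a² ℕ.+ b²) a²+b²+c²≡0)
  b²≡0 : b² ≡ 0
  b²≡0 = ℕ.m+n≡0⇒n≡0 a² (ℕ.m+n≡0⇒m≡0 (a² ℕ.+ b²) a²+b²+c²≡0)
  c²≡0 : c² ≡ 0
  c²≡0 = ℕ.m+n≡0⇒n≡0 (a² ℕ.+ b²) a²+b²+c²≡0

v·v≡L*L⇒v≢0 : ∀ {L v} → L ≢ 0ℤ → v · v ≡ L * L → v ≢ zero3
v·v≡L*L⇒v≢0 L≢0 v·v≡L² refl = i≢0⇒i*i≢0 L≢0 (sym v·v≡L²)

-- Completing twins to a frame

record Frame (L : ℤ) (u v w : Z3) : Set where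
  field
    u·u≡L² : u · u ≡ L * L
    v·v≡L² : v · v ≡ L * L
    w·w≡L² : w · w ≡ L * L
    u·v≡0 : u · v ≡ 0ℤ
    u·w≡0 : u · w ≡ 0ℤ
    v·w≡0 : v · w ≡ 0ℤ
    u⨯v≡Lw : u ⨯ v ≡ L ⊛ w
    v⨯w≡Lu : v ⨯ w ≡ L ⊛ u
    w⨯u≡Lv : w ⨯ u ≡ L ⊛ v

frame-icube : ∀ {L u v w} → L ≢ 0ℤ → Frame L u v w → Icube u v w
frame-icube L≢0 F =
  v·v≡L*L⇒v≢0 L≢0 u·u≡L² , v·v≡L*L⇒v≢0 L≢0 v·v≡L² , v·v≡L*L⇒v≢0 L≢0 w·w≡L² ,
  u·v≡0 , u·w≡0 , v·w≡0 , trans u·u≡L² (sym v·v≡L²) , trans v·v≡L² (sym w·w≡L²)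
  where open Frame F

module _ {L : ℤ} {v w : Z3} (L≢0 : L ≢ 0ℤ)
         (v·v≡L² : v · v ≡ L * L) (w·w≡L² : w · w ≡ L * L) (v·w≡0 : v · w ≡ 0ℤ) where

  L∣cross-component : ∀ {c} a b → c * c ≡ lagrange-term (v · v) (w · w) (v · w) a b → L ∣ c
  L∣cross-component {c} a b c²≡ = i*i≡j*j*k⇒j∣i L≢0 (begin
    c * c                                       ≡⟨ c²≡ ⟩
    lagrange-term (v · v) (w · w) (v · w) a b   ≡⟨ cong₃ (λ X Y Z → lagrange-term X Y Z a b) v·v≡L² w·w≡L² v·w≡0 ⟩
    lagrange-term (L * L) (L * L) 0ℤ a b        ≡⟨ twins-term L a b ⟩
    L * L * (L * L - a * a - b * b)             ∎)
    where
    twins-term : ∀ L a b → (L * L - a * a) * (L * L - b * b) - (0ℤ - a * b) * (0ℤ - a * b) ≡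
                           L * L * (L * L - a * a - b * b)
    twins-term = ℤ-Solver.solve-∀

  cross-divisible : ∃ λ u → v ⨯ w ≡ L ⊛ u
  cross-divisible = quotient (L∣cross-component (x₁ v) (x₁ w) (proj₁ (lagrange-components v w)))
                             (L∣cross-component (x₂ v) (x₂ w) (proj₁ (proj₂ (lagrange-components v w))))
                             (L∣cross-component (x₃ v) (x₃ w) (proj₂ (proj₂ (lagrange-components v w))))
    where
    quotient : L ∣ x₁ (v ⨯ w) → L ∣ x₂ (v ⨯ w) → L ∣ x₃ (v ⨯ w) → ∃ λ u → v ⨯ w ≡ L ⊛ u
    quotient (divides q₁ eq₁) (divides q₂ eq₂) (divides q₃ eq₃) =
      vec q₁ q₂ q₃ , cong₃ vec (trans eq₁ (ℤ.*-comm q₁ L)) (trans eq₂ (ℤ.*-comm q₂ L)) (trans eq₃ (ℤ.*-comm q₃ L))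

  L²⊛a⊞0⊛b≡L⊛L⊛a : ∀ a b → (L * L) ⊛ a ⊞ (- 0ℤ) ⊛ b ≡ L ⊛ (L ⊛ a)
  L²⊛a⊞0⊛b≡L⊛L⊛a (vec a₁ a₂ a₃) (vec b₁ b₂ b₃) =
    Z3-identity (L ∷ a₁ ∷ a₂ ∷ a₃ ∷ b₁ ∷ b₂ ∷ b₃ ∷ [])
      ((var 0 ⊗ᴱ var 0) S.⊛ a S.⊞ (⊝ᴱ Κ 0ℤ) S.⊛ b) (var 0 S.⊛ (var 0 S.⊛ a)) refl refl refl
    where
    a b : Z3ᴱ 7
    a = vecᴱ (var 1) (var 2) (var 3)
    b = vecᴱ (var 4) (var 5) (var 6)

  module _ {u : Z3} (v⨯w≡Lu : v ⨯ w ≡ L ⊛ u) where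

    cross⇒u·u≡L² : u · u ≡ L * L
    cross⇒u·u≡L² = *-cancelˡ (i≢0⇒i*i≢0 L≢0) (begin
      L * L * (u · u)                       ≡⟨ ⊛-·-⊛ L u ⟨
      (L ⊛ u) · (L ⊛ u)                     ≡⟨ cong (λ x → x · x) v⨯w≡Lu ⟨
      (v ⨯ w) · (v ⨯ w)                     ≡⟨ lagrange-identity v w ⟩
      (v · v) * (w · w) - (v · w) * (v · w) ≡⟨ cong₃ (λ X Y Z → X * Y - Z * Z) v·v≡L² w·w≡L² v·w≡0 ⟩
      L * L * (L * L) - 0ℤ * 0ℤ             ≡⟨ ℤ.+-identityʳ (L * L * (L * L)) ⟩
      L * L * (L * L)                       ∎)

    cross⇒u·v≡0 : u · v ≡ 0ℤ
    cross⇒u·v≡0 = *-cancelˡ L≢0 (begin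
      L * (u · v)        ≡⟨ ⊛-· L u v ⟨
      (L ⊛ u) · v        ≡⟨ cong (_· v) v⨯w≡Lu ⟨
      (v ⨯ w) · v        ≡⟨ [a⨯b]·a≡0 v w ⟩
      0ℤ                 ≡⟨ ℤ.*-zeroʳ L ⟨
      L * 0ℤ             ∎)

    cross⇒u·w≡0 : u · w ≡ 0ℤ
    cross⇒u·w≡0 = *-cancelˡ L≢0 (begin
      L * (u · w)        ≡⟨ ⊛-· L u w ⟨
      (L ⊛ u) · w        ≡⟨ cong (_· w) v⨯w≡Lu ⟨
      (v ⨯ w) · w        ≡⟨ [a⨯b]·b≡0 v w ⟩
      0ℤ                 ≡⟨ ℤ.*-zeroʳ L ⟨
      L * 0ℤ             ∎)

    cross⇒u⨯v≡Lw : u ⨯ v ≡ L ⊛ w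
    cross⇒u⨯v≡Lw = ⊛-cancelˡ L≢0 (begin
      L ⊛ (u ⨯ v)                     ≡⟨ ⊛-⨯ L u v ⟨
      (L ⊛ u) ⨯ v                     ≡⟨ cong (_⨯ v) v⨯w≡Lu ⟨
      (v ⨯ w) ⨯ v                     ≡⟨ ⨯-⨯ˡ v w v ⟩
      (v · v) ⊛ w ⊞ (- (w · v)) ⊛ v   ≡⟨ cong₂ (λ X Z → X ⊛ w ⊞ (- Z) ⊛ v) v·v≡L² (trans (·-comm w v) v·w≡0) ⟩
      (L * L) ⊛ w ⊞ (- 0ℤ) ⊛ v        ≡⟨ L²⊛a⊞0⊛b≡L⊛L⊛a w v ⟩
      L ⊛ (L ⊛ w)                     ∎)

    cross⇒w⨯u≡Lv : w ⨯ u ≡ L ⊛ v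
    cross⇒w⨯u≡Lv = ⊛-cancelˡ L≢0 (begin
      L ⊛ (w ⨯ u)                     ≡⟨ ⨯-⊛ L w u ⟨
      w ⨯ (L ⊛ u)                     ≡⟨ cong (w ⨯_) v⨯w≡Lu ⟨
      w ⨯ (v ⨯ w)                     ≡⟨ ⨯-⨯ʳ w v w ⟩
      (w · w) ⊛ v ⊞ (- (w · v)) ⊛ w   ≡⟨ cong₂ (λ X Z → X ⊛ v ⊞ (- Z) ⊛ w) w·w≡L² (trans (·-comm w v) v·w≡0) ⟩
      (L * L) ⊛ v ⊞ (- 0ℤ) ⊛ w        ≡⟨ L²⊛a⊞0⊛b≡L⊛L⊛a v w ⟩
      L ⊛ (L ⊛ v)                     ∎)

    cross-frame : Frame L u v w
    cross-frame = record
      { u·u≡L² = cross⇒u·u≡L² ; v·v≡L² = v·v≡L² ; w·w≡L² = w·w≡L²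
      ; u·v≡0 = cross⇒u·v≡0 ; u·w≡0 = cross⇒u·w≡0 ; v·w≡0 = v·w≡0
      ; u⨯v≡Lw = cross⇒u⨯v≡Lw ; v⨯w≡Lu = v⨯w≡Lu ; w⨯u≡Lv = cross⇒w⨯u≡Lv
      }

  twins-frame : ∃ λ u → Frame L u v w
  twins-frame = proj₁ cross-divisible , cross-frame (proj₂ cross-divisible)

⊗-assoc : ∀ α β γ → α ⊗ β ⊗ γ ≡ α ⊗ (β ⊗ γ)
⊗-assoc (quat a₀ (vec a₁ a₂ a₃)) (quat b₀ (vec b₁ b₂ b₃)) (quat c₀ (vec c₁ c₂ c₃)) =
  Q-identity (a₀ ∷ a₁ ∷ a₂ ∷ a₃ ∷ b₀ ∷ b₁ ∷ b₂ ∷ b₃ ∷ c₀ ∷ c₁ ∷ c₂ ∷ c₃ ∷ [])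
    (α S.⊗ β S.⊗ γ) (α S.⊗ (β S.⊗ γ)) refl refl refl refl
  where
  α β γ : S.Quaternion
  α = quatᴱ (var 0) (var 1) (var 2) (var 3)
  β = quatᴱ (var 4) (var 5) (var 6) (var 7)
  γ = quatᴱ (var 8) (var 9) (var 10) (var 11)

⊗-distribˡ-⊟ : ∀ α β γ → α ⊗ (β ⊟ γ) ≡ α ⊗ β ⊟ α ⊗ γ
⊗-distribˡ-⊟ (quat a₀ (vec a₁ a₂ a₃)) (quat b₀ (vec b₁ b₂ b₃)) (quat c₀ (vec c₁ c₂ c₃)) =
  Q-identity (a₀ ∷ a₁ ∷ a₂ ∷ a₃ ∷ b₀ ∷ b₁ ∷ b₂ ∷ b₃ ∷ c₀ ∷ c₁ ∷ c₂ ∷ c₃ ∷ [])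
    (α S.⊗ (β S.⊟ γ)) (α S.⊗ β S.⊟ α S.⊗ γ) refl refl refl refl
  where
  α β γ : S.Quaternion
  α = quatᴱ (var 0) (var 1) (var 2) (var 3)
  β = quatᴱ (var 4) (var 5) (var 6) (var 7)
  γ = quatᴱ (var 8) (var 9) (var 10) (var 11)

⊙-⊗ : ∀ c α β → c ⊙ α ⊗ β ≡ c ⊙ (α ⊗ β)
⊙-⊗ c (quat a₀ (vec a₁ a₂ a₃)) (quat b₀ (vec b₁ b₂ b₃)) =
  Q-identity (c ∷ a₀ ∷ a₁ ∷ a₂ ∷ a₃ ∷ b₀ ∷ b₁ ∷ b₂ ∷ b₃ ∷ [])
    (var 0 S.⊙ α S.⊗ β) (var 0 S.⊙ (α S.⊗ β)) refl refl refl refl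
  where
  α β : S.Quaternion
  α = quatᴱ (var 1) (var 2) (var 3) (var 4)
  β = quatᴱ (var 5) (var 6) (var 7) (var 8)

⊗-⊙ : ∀ c α β → α ⊗ (c ⊙ β) ≡ c ⊙ (α ⊗ β)
⊗-⊙ c (quat a₀ (vec a₁ a₂ a₃)) (quat b₀ (vec b₁ b₂ b₃)) =
  Q-identity (c ∷ a₀ ∷ a₁ ∷ a₂ ∷ a₃ ∷ b₀ ∷ b₁ ∷ b₂ ∷ b₃ ∷ [])
    (α S.⊗ (var 0 S.⊙ β)) (var 0 S.⊙ (α S.⊗ β)) refl refl refl refl
  where
  α β : S.Quaternion
  α = quatᴱ (var 1) (var 2) (var 3) (var 4)
  β = quatᴱ (var 5) (var 6) (var 7) (var 8)

⊗-norm : ∀ α β → α ⊗ β ⊗ conj β ≡ norm β ⊙ α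
⊗-norm (quat a₀ (vec a₁ a₂ a₃)) (quat b₀ (vec b₁ b₂ b₃)) =
  Q-identity (a₀ ∷ a₁ ∷ a₂ ∷ a₃ ∷ b₀ ∷ b₁ ∷ b₂ ∷ b₃ ∷ [])
    (α S.⊗ β S.⊗ S.conj β) (S.norm β S.⊙ α) refl refl refl refl
  where
  α β : S.Quaternion
  α = quatᴱ (var 0) (var 1) (var 2) (var 3)
  β = quatᴱ (var 4) (var 5) (var 6) (var 7)

0⊙ : ∀ α → 0ℤ ⊙ α ≡ 0q
0⊙ (quat a₀ (vec a₁ a₂ a₃)) = Q-identity (a₀ ∷ a₁ ∷ a₂ ∷ a₃ ∷ []) (Κ 0ℤ S.⊙ α) S.0q refl refl refl refl
  where
  α : S.Quaternion
  α = quatᴱ (var 0) (var 1) (var 2) (var 3)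

norm-⊙ : ∀ c α → norm (c ⊙ α) ≡ c * c * norm α
norm-⊙ c (quat a₀ (vec a₁ a₂ a₃)) =
  ℤ-identity (c ∷ a₀ ∷ a₁ ∷ a₂ ∷ a₃ ∷ []) (S.norm (var 0 S.⊙ α)) (var 0 ⊗ᴱ var 0 ⊗ᴱ S.norm α) refl
  where
  α : S.Quaternion
  α = quatᴱ (var 1) (var 2) (var 3) (var 4)

pure-⊗-pure : ∀ a b → pure a ⊗ pure b ≡ quat (- (a · b)) (a ⨯ b)
pure-⊗-pure (vec a₁ a₂ a₃) (vec b₁ b₂ b₃) =
  Q-identity (a₁ ∷ a₂ ∷ a₃ ∷ b₁ ∷ b₂ ∷ b₃ ∷ []) (S.pure a S.⊗ S.pure b) (S.quat (⊝ᴱ (a S.· b)) (a S.⨯ b))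
    refl refl refl refl
  where
  a b : Z3ᴱ 6
  a = vecᴱ (var 0) (var 1) (var 2)
  b = vecᴱ (var 3) (var 4) (var 5)

pure-⊗-orthogonal : ∀ a b k c → a · b ≡ 0ℤ → a ⨯ b ≡ k ⊛ c → pure a ⊗ pure b ≡ k ⊙ pure c
pure-⊗-orthogonal a b k c a·b≡0 a⨯b≡kc = begin
  pure a ⊗ pure b            ≡⟨ pure-⊗-pure a b ⟩
  quat (- (a · b)) (a ⨯ b)   ≡⟨ cong₂ quat (trans (cong -_ a·b≡0) (sym (ℤ.*-zeroʳ k))) a⨯b≡kc ⟩
  k ⊙ pure c                 ∎

pure-⊗-self : ∀ a L → a · a ≡ L * L → pure a ⊗ pure a ≡ (- (L * L)) ⊙ 𝟏
pure-⊗-self a L a·a≡L² = begin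
  pure a ⊗ pure a              ≡⟨ pure-⊗-pure a a ⟩
  quat (- (a · a)) (a ⨯ a)     ≡⟨ cong₂ quat (cong -_ a·a≡L²) (a⨯a≡0 a) ⟩
  quat (- (L * L)) zero3       ≡⟨ Q-identity (L ∷ []) (S.quat (⊝ᴱ (var 0 ⊗ᴱ var 0)) S.zero3)
                                   ((⊝ᴱ (var 0 ⊗ᴱ var 0)) S.⊙ S.𝟏) refl refl refl refl ⟩
  (- (L * L)) ⊙ 𝟏              ∎

⊗𝐢⊗conj≡E₁ : ∀ α → α ⊗ 𝐢 ⊗ conj α ≡ pure (E₁ α)
⊗𝐢⊗conj≡E₁ (quat a₀ (vec a₁ a₂ a₃)) =
  Q-identity (a₀ ∷ a₁ ∷ a₂ ∷ a₃ ∷ []) (α S.⊗ S.𝐢 S.⊗ S.conj α) (S.pure (S.E₁ α)) refl refl refl refl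
  where
  α : S.Quaternion
  α = quatᴱ (var 0) (var 1) (var 2) (var 3)

⊗𝐣⊗conj≡E₂ : ∀ α → α ⊗ 𝐣 ⊗ conj α ≡ pure (E₂ α)
⊗𝐣⊗conj≡E₂ (quat a₀ (vec a₁ a₂ a₃)) =
  Q-identity (a₀ ∷ a₁ ∷ a₂ ∷ a₃ ∷ []) (α S.⊗ S.𝐣 S.⊗ S.conj α) (S.pure (S.E₂ α)) refl refl refl refl
  where
  α : S.Quaternion
  α = quatᴱ (var 0) (var 1) (var 2) (var 3)

⊗𝐤⊗conj≡E₃ : ∀ α → α ⊗ 𝐤 ⊗ conj α ≡ pure (E₃ α)
⊗𝐤⊗conj≡E₃ (quat a₀ (vec a₁ a₂ a₃)) =
  Q-identity (a₀ ∷ a₁ ∷ a₂ ∷ a₃ ∷ []) (α S.⊗ S.𝐤 S.⊗ S.conj α) (S.pure (S.E₃ α)) refl refl refl refl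
  where
  α : S.Quaternion
  α = quatᴱ (var 0) (var 1) (var 2) (var 3)

E₁-⊙ : ∀ c α → E₁ (c ⊙ α) ≡ (c * c) ⊛ E₁ α
E₁-⊙ c (quat a₀ (vec a₁ a₂ a₃)) =
  Z3-identity (c ∷ a₀ ∷ a₁ ∷ a₂ ∷ a₃ ∷ []) (S.E₁ (var 0 S.⊙ α)) ((var 0 ⊗ᴱ var 0) S.⊛ S.E₁ α) refl refl refl
  where
  α : S.Quaternion
  α = quatᴱ (var 1) (var 2) (var 3) (var 4)

E₂-⊙ : ∀ c α → E₂ (c ⊙ α) ≡ (c * c) ⊛ E₂ α
E₂-⊙ c (quat a₀ (vec a₁ a₂ a₃)) =
  Z3-identity (c ∷ a₀ ∷ a₁ ∷ a₂ ∷ a₃ ∷ []) (S.E₂ (var 0 S.⊙ α)) ((var 0 ⊗ᴱ var 0) S.⊛ S.E₂ α) refl refl refl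
  where
  α : S.Quaternion
  α = quatᴱ (var 1) (var 2) (var 3) (var 4)

E₃-⊙ : ∀ c α → E₃ (c ⊙ α) ≡ (c * c) ⊛ E₃ α
E₃-⊙ c (quat a₀ (vec a₁ a₂ a₃)) =
  Z3-identity (c ∷ a₀ ∷ a₁ ∷ a₂ ∷ a₃ ∷ []) (S.E₃ (var 0 S.⊙ α)) ((var 0 ⊗ᴱ var 0) S.⊛ S.E₃ α) refl refl refl
  where
  α : S.Quaternion
  α = quatᴱ (var 1) (var 2) (var 3) (var 4)

Represents : ℤ → Q → Z3 → Z3 → Z3 → Set
Represents L α u v w = L ⊛ E₁ α ≡ norm α ⊛ u × L ⊛ E₂ α ≡ norm α ⊛ v × L ⊛ E₃ α ≡ norm α ⊛ w

-- From a frame to a quaternion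

⊗-ijk-combination : ∀ P L x A B C →
  P ⊗ ijk-combination L x A B C ≡ L ⊙ (P ⊗ x) ⊟ P ⊗ (A ⊗ 𝐢) ⊟ P ⊗ (B ⊗ 𝐣) ⊟ P ⊗ (C ⊗ 𝐤)
⊗-ijk-combination P L x A B C = begin
  P ⊗ (L ⊙ x ⊟ A ⊗ 𝐢 ⊟ B ⊗ 𝐣 ⊟ C ⊗ 𝐤)
    ≡⟨ ⊗-distribˡ-⊟ P _ _ ⟩
  P ⊗ (L ⊙ x ⊟ A ⊗ 𝐢 ⊟ B ⊗ 𝐣) ⊟ P ⊗ (C ⊗ 𝐤)
    ≡⟨ cong (_⊟ P ⊗ (C ⊗ 𝐤)) (⊗-distribˡ-⊟ P _ _) ⟩
  P ⊗ (L ⊙ x ⊟ A ⊗ 𝐢) ⊟ P ⊗ (B ⊗ 𝐣) ⊟ P ⊗ (C ⊗ 𝐤)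
    ≡⟨ cong (λ y → y ⊟ P ⊗ (B ⊗ 𝐣) ⊟ P ⊗ (C ⊗ 𝐤)) (⊗-distribˡ-⊟ P _ _) ⟩
  P ⊗ (L ⊙ x) ⊟ P ⊗ (A ⊗ 𝐢) ⊟ P ⊗ (B ⊗ 𝐣) ⊟ P ⊗ (C ⊗ 𝐤)
    ≡⟨ cong (λ y → y ⊟ P ⊗ (A ⊗ 𝐢) ⊟ P ⊗ (B ⊗ 𝐣) ⊟ P ⊗ (C ⊗ 𝐤)) (⊗-⊙ L P x) ⟩
  L ⊙ (P ⊗ x) ⊟ P ⊗ (A ⊗ 𝐢) ⊟ P ⊗ (B ⊗ 𝐣) ⊟ P ⊗ (C ⊗ 𝐤)
    ∎

⊗-reassociate : ∀ P U k R x e → P ⊗ U ≡ k ⊙ R → P ⊗ (U ⊗ x ⊗ e) ≡ k ⊙ (R ⊗ x) ⊗ e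
⊗-reassociate P U k R x e P⊗U≡kR = begin
  P ⊗ (U ⊗ x ⊗ e)      ≡⟨ ⊗-assoc P (U ⊗ x) e ⟨
  P ⊗ (U ⊗ x) ⊗ e      ≡⟨ cong (_⊗ e) (⊗-assoc P U x) ⟨
  P ⊗ U ⊗ x ⊗ e        ≡⟨ cong (λ y → y ⊗ x ⊗ e) P⊗U≡kR ⟩
  k ⊙ R ⊗ x ⊗ e        ≡⟨ cong (_⊗ e) (⊙-⊗ k R x) ⟩
  k ⊙ (R ⊗ x) ⊗ e      ∎

⊗-frame-quaternion : ∀ P L u v w k₁ k₂ k₃ R₁ R₂ R₃ x →
  P ⊗ pure u ≡ k₁ ⊙ R₁ → P ⊗ pure v ≡ k₂ ⊙ R₂ → P ⊗ pure w ≡ k₃ ⊙ R₃ →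
  P ⊗ frame-quaternion L u v w x ≡ L ⊙ (P ⊗ x) ⊟ k₁ ⊙ (R₁ ⊗ x) ⊗ 𝐢 ⊟ k₂ ⊙ (R₂ ⊗ x) ⊗ 𝐣 ⊟ k₃ ⊙ (R₃ ⊗ x) ⊗ 𝐤
⊗-frame-quaternion P L u v w k₁ k₂ k₃ R₁ R₂ R₃ x P⊗U P⊗V P⊗W =
  trans (⊗-ijk-combination P L x (pure u ⊗ x) (pure v ⊗ x) (pure w ⊗ x))
        (cong₃ (λ y₁ y₂ y₃ → L ⊙ (P ⊗ x) ⊟ y₁ ⊟ y₂ ⊟ y₃)
               (⊗-reassociate P (pure u) k₁ R₁ x 𝐢 P⊗U) (⊗-reassociate P (pure v) k₂ R₂ x 𝐣 P⊗V)
               (⊗-reassociate P (pure w) k₃ R₃ x 𝐤 P⊗W))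

private
  Lᴱ : Expr ℤ 17
  Lᴱ = var 0
  xᴱ Aᴱ Bᴱ Cᴱ : S.Quaternion {17}
  xᴱ = quatᴱ (var 1) (var 2) (var 3) (var 4)
  Aᴱ = quatᴱ (var 5) (var 6) (var 7) (var 8)
  Bᴱ = quatᴱ (var 9) (var 10) (var 11) (var 12)
  Cᴱ = quatᴱ (var 13) (var 14) (var 15) (var 16)

  ρ⟨_,_,_,_,_⟩ : ℤ → Q → Q → Q → Q → Vec ℤ 17
  ρ⟨ L , quat x₀ (vec x₁′ x₂′ x₃′) , quat a₀ (vec a₁ a₂ a₃) , quat b₀ (vec b₁ b₂ b₃) , quat c₀ (vec c₁ c₂ c₃) ⟩ =
    L ∷ x₀ ∷ x₁′ ∷ x₂′ ∷ x₃′ ∷ a₀ ∷ a₁ ∷ a₂ ∷ a₃ ∷ b₀ ∷ b₁ ∷ b₂ ∷ b₃ ∷ c₀ ∷ c₁ ∷ c₂ ∷ c₃ ∷ []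

ijk-combination-⊗𝐢 : ∀ L x A B C →
  L ⊙ A ⊟ (- (L * L)) ⊙ (𝟏 ⊗ x) ⊗ 𝐢 ⊟ L ⊙ C ⊗ 𝐣 ⊟ (- L) ⊙ B ⊗ 𝐤 ≡ L ⊙ (ijk-combination L x A B C ⊗ 𝐢)
ijk-combination-⊗𝐢 L x@(quat _ (vec _ _ _)) A@(quat _ (vec _ _ _)) B@(quat _ (vec _ _ _)) C@(quat _ (vec _ _ _)) =
  Q-identity ρ⟨ L , x , A , B , C ⟩
    (Lᴱ S.⊙ Aᴱ S.⊟ (⊝ᴱ (Lᴱ ⊗ᴱ Lᴱ)) S.⊙ (S.𝟏 S.⊗ xᴱ) S.⊗ S.𝐢 S.⊟ Lᴱ S.⊙ Cᴱ S.⊗ S.𝐣 S.⊟ (⊝ᴱ Lᴱ) S.⊙ Bᴱ S.⊗ S.𝐤)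
    (Lᴱ S.⊙ (S.ijk-combination Lᴱ xᴱ Aᴱ Bᴱ Cᴱ S.⊗ S.𝐢)) refl refl refl refl

ijk-combination-⊗𝐣 : ∀ L x A B C →
  L ⊙ B ⊟ (- L) ⊙ C ⊗ 𝐢 ⊟ (- (L * L)) ⊙ (𝟏 ⊗ x) ⊗ 𝐣 ⊟ L ⊙ A ⊗ 𝐤 ≡ L ⊙ (ijk-combination L x A B C ⊗ 𝐣)
ijk-combination-⊗𝐣 L x@(quat _ (vec _ _ _)) A@(quat _ (vec _ _ _)) B@(quat _ (vec _ _ _)) C@(quat _ (vec _ _ _)) =
  Q-identity ρ⟨ L , x , A , B , C ⟩
    (Lᴱ S.⊙ Bᴱ S.⊟ (⊝ᴱ Lᴱ) S.⊙ Cᴱ S.⊗ S.𝐢 S.⊟ (⊝ᴱ (Lᴱ ⊗ᴱ Lᴱ)) S.⊙ (S.𝟏 S.⊗ xᴱ) S.⊗ S.𝐣 S.⊟ Lᴱ S.⊙ Aᴱ S.⊗ S.𝐤)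
    (Lᴱ S.⊙ (S.ijk-combination Lᴱ xᴱ Aᴱ Bᴱ Cᴱ S.⊗ S.𝐣)) refl refl refl refl

ijk-combination-⊗𝐤 : ∀ L x A B C →
  L ⊙ C ⊟ L ⊙ B ⊗ 𝐢 ⊟ (- L) ⊙ A ⊗ 𝐣 ⊟ (- (L * L)) ⊙ (𝟏 ⊗ x) ⊗ 𝐤 ≡ L ⊙ (ijk-combination L x A B C ⊗ 𝐤)
ijk-combination-⊗𝐤 L x@(quat _ (vec _ _ _)) A@(quat _ (vec _ _ _)) B@(quat _ (vec _ _ _)) C@(quat _ (vec _ _ _)) =
  Q-identity ρ⟨ L , x , A , B , C ⟩
    (Lᴱ S.⊙ Cᴱ S.⊟ Lᴱ S.⊙ Bᴱ S.⊗ S.𝐢 S.⊟ (⊝ᴱ Lᴱ) S.⊙ Aᴱ S.⊗ S.𝐣 S.⊟ (⊝ᴱ (Lᴱ ⊗ᴱ Lᴱ)) S.⊙ (S.𝟏 S.⊗ xᴱ) S.⊗ S.𝐤)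
    (Lᴱ S.⊙ (S.ijk-combination Lᴱ xᴱ Aᴱ Bᴱ Cᴱ S.⊗ S.𝐤)) refl refl refl refl

intertwining⇒column : ∀ L β e p E → β ⊗ e ⊗ conj β ≡ pure E → pure p ⊗ β ≡ L ⊙ (β ⊗ e) →
                      L ⊛ E ≡ norm β ⊛ p
intertwining⇒column L β e p E β⊗e⊗conjβ≡E intertwines = cong im (begin
  L ⊙ pure E                ≡⟨ cong (L ⊙_) β⊗e⊗conjβ≡E ⟨
  L ⊙ (β ⊗ e ⊗ conj β)      ≡⟨ ⊙-⊗ L (β ⊗ e) (conj β) ⟨
  L ⊙ (β ⊗ e) ⊗ conj β      ≡⟨ cong (_⊗ conj β) intertwines ⟨
  pure p ⊗ β ⊗ conj β       ≡⟨ ⊗-norm (pure p) β ⟩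
  norm β ⊙ pure p           ∎)

module _ {L : ℤ} {u v w : Z3} (F : Frame L u v w) where
  open Frame F

  private
    v·u≡0 : v · u ≡ 0ℤ
    v·u≡0 = trans (·-comm v u) u·v≡0
    w·u≡0 : w · u ≡ 0ℤ
    w·u≡0 = trans (·-comm w u) u·w≡0
    w·v≡0 : w · v ≡ 0ℤ
    w·v≡0 = trans (·-comm w v) v·w≡0
    U V W : Q
    U = pure u
    V = pure v
    W = pure w

  frame-represents : ∀ x → Represents L (frame-quaternion L u v w x) u v w
  frame-represents x =
    intertwining⇒column L β 𝐢 u (E₁ β) (⊗𝐢⊗conj≡E₁ β) (trans
      (⊗-frame-quaternion U L u v w (- (L * L)) L (- L) 𝟏 W V x
        (pure-⊗-self u L u·u≡L²)
        (pure-⊗-orthogonal u v L w u·v≡0 u⨯v≡Lw)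
        (pure-⊗-orthogonal u w (- L) v u·w≡0 (a⨯b≡kc⇒b⨯a≡-kc w u L v w⨯u≡Lv)))
      (ijk-combination-⊗𝐢 L x (U ⊗ x) (V ⊗ x) (W ⊗ x))) ,
    intertwining⇒column L β 𝐣 v (E₂ β) (⊗𝐣⊗conj≡E₂ β) (trans
      (⊗-frame-quaternion V L u v w (- L) (- (L * L)) L W 𝟏 U x
        (pure-⊗-orthogonal v u (- L) w v·u≡0 (a⨯b≡kc⇒b⨯a≡-kc u v L w u⨯v≡Lw))
        (pure-⊗-self v L v·v≡L²)
        (pure-⊗-orthogonal v w L u v·w≡0 v⨯w≡Lu))
      (ijk-combination-⊗𝐣 L x (U ⊗ x) (V ⊗ x) (W ⊗ x))) ,
    intertwining⇒column L β 𝐤 w (E₃ β) (⊗𝐤⊗conj≡E₃ β) (trans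
      (⊗-frame-quaternion W L u v w L (- L) (- (L * L)) V U 𝟏 x
        (pure-⊗-orthogonal w u L v w·u≡0 w⨯u≡Lv)
        (pure-⊗-orthogonal w v (- L) u w·v≡0 (a⨯b≡kc⇒b⨯a≡-kc v w L u v⨯w≡Lu))
        (pure-⊗-self w L w·w≡L²))
      (ijk-combination-⊗𝐤 L x (U ⊗ x) (V ⊗ x) (W ⊗ x)))
    where
    β : Q
    β = frame-quaternion L u v w x

frame-quaternion-trace : ∀ L u v w →
  re (frame-quaternion L u v w 𝟏) + x₁ (im (frame-quaternion L u v w 𝐢)) +
  x₂ (im (frame-quaternion L u v w 𝐣)) + x₃ (im (frame-quaternion L u v w 𝐤)) ≡ + 4 * L
frame-quaternion-trace L (vec u₁ u₂ u₃) (vec v₁ v₂ v₃) (vec w₁ w₂ w₃) =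
  ℤ-identity (L ∷ u₁ ∷ u₂ ∷ u₃ ∷ v₁ ∷ v₂ ∷ v₃ ∷ w₁ ∷ w₂ ∷ w₃ ∷ [])
    (S.re (β S.𝟏) ⊕ᴱ y₁ (S.im (β S.𝐢)) ⊕ᴱ y₂ (S.im (β S.𝐣)) ⊕ᴱ y₃ (S.im (β S.𝐤))) (Κ (+ 4) ⊗ᴱ var 0) refl
  where
  β : S.Quaternion → S.Quaternion
  β = S.frame-quaternion (var 0) (vecᴱ (var 1) (var 2) (var 3)) (vecᴱ (var 4) (var 5) (var 6)) (vecᴱ (var 7) (var 8) (var 9))

frame-quaternion-nonzero : ∀ {L} u v w → L ≢ 0ℤ → ∃ λ x → frame-quaternion L u v w x ≢ 0q
frame-quaternion-nonzero {L} u v w L≢0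
  with re (β 𝟏) ≟ 0ℤ | x₁ (im (β 𝐢)) ≟ 0ℤ | x₂ (im (β 𝐣)) ≟ 0ℤ | x₃ (im (β 𝐤)) ≟ 0ℤ
  where
  β : Q → Q
  β = frame-quaternion L u v w
... | no t₀≢0 | _ | _ | _ = 𝟏 , λ β≡0 → t₀≢0 (cong re β≡0)
... | yes _ | no t₁≢0 | _ | _ = 𝐢 , λ β≡0 → t₁≢0 (cong (λ q → x₁ (im q)) β≡0)
... | yes _ | yes _ | no t₂≢0 | _ = 𝐣 , λ β≡0 → t₂≢0 (cong (λ q → x₂ (im q)) β≡0)
... | yes _ | yes _ | yes _ | no t₃≢0 = 𝐤 , λ β≡0 → t₃≢0 (cong (λ q → x₃ (im q)) β≡0)
... | yes t₀≡0 | yes t₁≡0 | yes t₂≡0 | yes t₃≡0 = ⊥-elim (L≢0 (*-cancelˡ {k = + 4} (λ ()) 4L≡4*0))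
  where
  4L≡4*0 : + 4 * L ≡ + 4 * 0ℤ
  4L≡4*0 = trans (sym (frame-quaternion-trace L u v w))
                 (cong₂ _+_ (cong₃ (λ a b c → a + b + c) t₀≡0 t₁≡0 t₂≡0) t₃≡0)

Primitive : Q → Set
Primitive α = ∃ λ s → ⟪ s , α ⟫ ≡ + 1

⟪⟫-⊙ : ∀ s c α → ⟪ s , c ⊙ α ⟫ ≡ c * ⟪ s , α ⟫
⟪⟫-⊙ (quat s₀ (vec s₁ s₂ s₃)) c (quat a₀ (vec a₁ a₂ a₃)) =
  ℤ-identity (s₀ ∷ s₁ ∷ s₂ ∷ s₃ ∷ c ∷ a₀ ∷ a₁ ∷ a₂ ∷ a₃ ∷ []) (S.⟪ s , var 4 S.⊙ α ⟫) (var 4 ⊗ᴱ S.⟪ s , α ⟫) refl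
  where
  s α : S.Quaternion
  s = quatᴱ (var 0) (var 1) (var 2) (var 3)
  α = quatᴱ (var 5) (var 6) (var 7) (var 8)

primitive-part : ∀ β → β ≢ 0q → ∃ λ g → ∃ λ α → g ≢ 0ℤ × β ≡ g ⊙ α × Primitive α
primitive-part (quat b₀ (vec b₁ b₂ b₃)) β≢0
  with bézout b₀ b₁
... | record { gcd = g₁ ; gcd∣a = g₁∣b₀ ; gcd∣b = g₁∣b₁ ; x = s₁ ; y = t₁ ; identity = id₁ }
  with bézout g₁ b₂
... | record { gcd = g₂ ; gcd∣a = g₂∣g₁ ; gcd∣b = g₂∣b₂ ; x = s₂ ; y = t₂ ; identity = id₂ }
  with bézout g₂ b₃
... | record { gcd = g ; gcd∣a = g∣g₂ ; gcd∣b = g∣b₃ ; x = s₃ ; y = t₃ ; identity = id₃ } =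
  quotient (∣-trans g∣g₂ (∣-trans g₂∣g₁ g₁∣b₀)) (∣-trans g∣g₂ (∣-trans g₂∣g₁ g₁∣b₁))
           (∣-trans g∣g₂ g₂∣b₂) g∣b₃
  where
  β s : Q
  β = quat b₀ (vec b₁ b₂ b₃)
  s = quat (s₃ * s₂ * s₁) (vec (s₃ * s₂ * t₁) (s₃ * t₂) t₃)
  nest : ∀ s₁ t₁ s₂ t₂ s₃ t₃ b₀ b₁ b₂ b₃ →
    s₃ * s₂ * s₁ * b₀ + (s₃ * s₂ * t₁ * b₁ + s₃ * t₂ * b₂ + t₃ * b₃) ≡
    s₃ * (s₂ * (s₁ * b₀ + t₁ * b₁) + t₂ * b₂) + t₃ * b₃
  nest = ℤ-Solver.solve-∀
  ⟪s,β⟫≡g : ⟪ s , β ⟫ ≡ g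
  ⟪s,β⟫≡g = begin
    ⟪ s , β ⟫                                            ≡⟨ nest s₁ t₁ s₂ t₂ s₃ t₃ b₀ b₁ b₂ b₃ ⟩
    s₃ * (s₂ * (s₁ * b₀ + t₁ * b₁) + t₂ * b₂) + t₃ * b₃  ≡⟨ cong (λ t → s₃ * (s₂ * t + t₂ * b₂) + t₃ * b₃) id₁ ⟩
    s₃ * (s₂ * g₁ + t₂ * b₂) + t₃ * b₃                   ≡⟨ cong (λ t → s₃ * t + t₃ * b₃) id₂ ⟩
    s₃ * g₂ + t₃ * b₃                                    ≡⟨ id₃ ⟩
    g                                                    ∎
  quotient : g ∣ b₀ → g ∣ b₁ → g ∣ b₂ → g ∣ b₃ → ∃ λ g → ∃ λ α → g ≢ 0ℤ × β ≡ g ⊙ α × Primitive α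
  quotient (divides q₀ b₀≡q₀g) (divides q₁ b₁≡q₁g) (divides q₂ b₂≡q₂g) (divides q₃ b₃≡q₃g) =
    g , α , g≢0 , β≡gα , s , *-cancelˡ g≢0 (begin
      g * ⟪ s , α ⟫   ≡⟨ ⟪⟫-⊙ s g α ⟨
      ⟪ s , g ⊙ α ⟫   ≡⟨ cong ⟪ s ,_⟫ β≡gα ⟨
      ⟪ s , β ⟫       ≡⟨ ⟪s,β⟫≡g ⟩
      g               ≡⟨ ℤ.*-identityʳ g ⟨
      g * + 1         ∎)
    where
    α : Q
    α = quat q₀ (vec q₁ q₂ q₃)
    β≡gα : β ≡ g ⊙ α
    β≡gα = cong₂ quat (trans b₀≡q₀g (ℤ.*-comm q₀ g))
             (cong₃ vec (trans b₁≡q₁g (ℤ.*-comm q₁ g)) (trans b₂≡q₂g (ℤ.*-comm q₂ g)) (trans b₃≡q₃g (ℤ.*-comm q₃ g)))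
    g≢0 : g ≢ 0ℤ
    g≢0 g≡0 = β≢0 (begin
      β         ≡⟨ β≡gα ⟩
      g ⊙ α     ≡⟨ cong (_⊙ α) g≡0 ⟩
      0ℤ ⊙ α    ≡⟨ 0⊙ α ⟩
      0q        ∎)

column-transport : ∀ L {E E′ N N′} c n m m′ → E′ ≡ c ⊛ E → N′ ≡ n * N → c ⊛ m ≡ n ⊛ m′ →
  L ⊛ E ≡ N ⊛ m → L ⊛ E′ ≡ N′ ⊛ m′
column-transport L {E} {E′} {N} {N′} c n m m′ E′≡cE N′≡nN cm≡nm′ column = begin
  L ⊛ E′            ≡⟨ cong (L ⊛_) E′≡cE ⟩
  L ⊛ (c ⊛ E)       ≡⟨ ⊛-comm L c E ⟩
  c ⊛ (L ⊛ E)       ≡⟨ cong (c ⊛_) column ⟩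
  c ⊛ (N ⊛ m)       ≡⟨ ⊛-comm c N m ⟩
  N ⊛ (c ⊛ m)       ≡⟨ cong (N ⊛_) cm≡nm′ ⟩
  N ⊛ (n ⊛ m′)      ≡⟨ ⊛-comm N n m′ ⟩
  n ⊛ (N ⊛ m′)      ≡⟨ ⊛-assoc n N m′ ⟨
  (n * N) ⊛ m′      ≡⟨ cong (_⊛ m′) N′≡nN ⟨
  N′ ⊛ m′           ∎

column-descale : ∀ L {E E′ N N′} k m → k ≢ 0ℤ → E′ ≡ k ⊛ E → N′ ≡ k * N →
  L ⊛ E′ ≡ N′ ⊛ m → L ⊛ E ≡ N ⊛ m
column-descale L {E} {E′} {N} {N′} k m k≢0 E′≡kE N′≡kN column = ⊛-cancelˡ k≢0 (begin
  k ⊛ (L ⊛ E)      ≡⟨ ⊛-comm k L E ⟩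
  L ⊛ (k ⊛ E)      ≡⟨ cong (L ⊛_) E′≡kE ⟨
  L ⊛ E′           ≡⟨ column ⟩
  N′ ⊛ m           ≡⟨ cong (_⊛ m) N′≡kN ⟩
  (k * N) ⊛ m      ≡⟨ ⊛-assoc k N m ⟩
  k ⊛ (N ⊛ m)      ∎)

column-rescale : ∀ L N c d E m → L ≢ 0ℤ → L ⊛ E ≡ N ⊛ m → c * L ≡ d * N → d ⊛ E ≡ c ⊛ m
column-rescale L N c d E m L≢0 column cL≡dN = ⊛-cancelˡ L≢0 (begin
  L ⊛ (d ⊛ E)     ≡⟨ ⊛-comm L d E ⟩
  d ⊛ (L ⊛ E)     ≡⟨ cong (d ⊛_) column ⟩
  d ⊛ (N ⊛ m)     ≡⟨ ⊛-assoc d N m ⟨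
  (d * N) ⊛ m     ≡⟨ cong (_⊛ m) cL≡dN ⟨
  (c * L) ⊛ m     ≡⟨ cong (_⊛ m) (ℤ.*-comm c L) ⟩
  (L * c) ⊛ m     ≡⟨ ⊛-assoc L c m ⟩
  L ⊛ (c ⊛ m)     ∎)

represents-descale : ∀ {L u v w} α c → c ≢ 0ℤ → Represents L (c ⊙ α) u v w → Represents L α u v w
represents-descale {L} {u} {v} {w} α c c≢0 (col₁ , col₂ , col₃) =
  column-descale L (c * c) u c²≢0 (E₁-⊙ c α) (norm-⊙ c α) col₁ ,
  column-descale L (c * c) v c²≢0 (E₂-⊙ c α) (norm-⊙ c α) col₂ ,
  column-descale L (c * c) w c²≢0 (E₃-⊙ c α) (norm-⊙ c α) col₃
  where
  c²≢0 : c * c ≢ 0ℤ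
  c²≢0 = i≢0⇒i*i≢0 c≢0

-- The Hurwitz quaternion

form-E : ∀ α s → form (norm α) (E₁ α) (E₂ α) (E₃ α) s ≡ + 4 * (⟪ s , α ⟫ * ⟪ s , α ⟫)
form-E (quat a₀ (vec a₁ a₂ a₃)) (quat s₀ (vec s₁ s₂ s₃)) =
  ℤ-identity (a₀ ∷ a₁ ∷ a₂ ∷ a₃ ∷ s₀ ∷ s₁ ∷ s₂ ∷ s₃ ∷ [])
    (S.form (S.norm α) (S.E₁ α) (S.E₂ α) (S.E₃ α) s) (Κ (+ 4) ⊗ᴱ (S.⟪ s , α ⟫ ⊗ᴱ S.⟪ s , α ⟫)) refl
  where
  α s : S.Quaternion
  α = quatᴱ (var 0) (var 1) (var 2) (var 3)
  s = quatᴱ (var 4) (var 5) (var 6) (var 7)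

form-⊛ : ∀ c k u v w s → form (c * k) (k ⊛ u) (k ⊛ v) (k ⊛ w) s ≡ k * form c u v w s
form-⊛ c k (vec u₁ u₂ u₃) (vec v₁ v₂ v₃) (vec w₁ w₂ w₃) (quat s₀ (vec s₁ s₂ s₃)) =
  ℤ-identity (c ∷ k ∷ u₁ ∷ u₂ ∷ u₃ ∷ v₁ ∷ v₂ ∷ v₃ ∷ w₁ ∷ w₂ ∷ w₃ ∷ s₀ ∷ s₁ ∷ s₂ ∷ s₃ ∷ [])
    (S.form (var 0 ⊗ᴱ var 1) (var 1 S.⊛ u) (var 1 S.⊛ v) (var 1 S.⊛ w) s) (var 1 ⊗ᴱ S.form (var 0) u v w s) refl
  where
  u v w : Z3ᴱ 15
  u = vecᴱ (var 2) (var 3) (var 4)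
  v = vecᴱ (var 5) (var 6) (var 7)
  w = vecᴱ (var 8) (var 9) (var 10)
  s : S.Quaternion
  s = quatᴱ (var 11) (var 12) (var 13) (var 14)

norm*form : ∀ L α u v w → Represents L α u v w →
  ∀ s → norm α * form L u v w s ≡ + 4 * L * (⟪ s , α ⟫ * ⟪ s , α ⟫)
norm*form L α u v w (col₁ , col₂ , col₃) s = begin
  N * form L u v w s                                  ≡⟨ form-⊛ L N u v w s ⟨
  form (L * N) (N ⊛ u) (N ⊛ v) (N ⊛ w) s              ≡⟨ cong₃ (λ a b c → form (L * N) a b c s) col₁ col₂ col₃ ⟨
  form (L * N) (L ⊛ E₁ α) (L ⊛ E₂ α) (L ⊛ E₃ α) s     ≡⟨ cong (λ c → form c (L ⊛ E₁ α) (L ⊛ E₂ α) (L ⊛ E₃ α) s) (ℤ.*-comm L N) ⟩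
  form (N * L) (L ⊛ E₁ α) (L ⊛ E₂ α) (L ⊛ E₃ α) s     ≡⟨ form-⊛ N L (E₁ α) (E₂ α) (E₃ α) s ⟩
  L * form N (E₁ α) (E₂ α) (E₃ α) s                   ≡⟨ cong (L *_) (form-E α s) ⟩
  L * (+ 4 * (⟪ s , α ⟫ * ⟪ s , α ⟫))                 ≡⟨ regroup L (⟪ s , α ⟫ * ⟪ s , α ⟫) ⟩
  + 4 * L * (⟪ s , α ⟫ * ⟪ s , α ⟫)                   ∎
  where
  N : ℤ
  N = norm α
  regroup : ∀ L x → L * (+ 4 * x) ≡ + 4 * L * x
  regroup = ℤ-Solver.solve-∀

form-pairs-even : ∀ c u v w →
  Even (form c u v w (quat (+ 1) (vec (+ 1) 0ℤ 0ℤ))) ×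
  Even (form c u v w (quat (+ 1) (vec 0ℤ (+ 1) 0ℤ))) ×
  Even (form c u v w (quat (+ 1) (vec 0ℤ 0ℤ (+ 1))))
form-pairs-even c (vec u₁ u₂ u₃) (vec v₁ v₂ v₃) (vec w₁ w₂ w₃) =
  (c + u₁ + v₃ - w₂ , pair (vecᴱ (Κ (+ 1)) (Κ 0ℤ) (Κ 0ℤ)) (var 0 ⊕ᴱ var 1 ⊕ᴱ var 6 ⊕ᴱ ⊝ᴱ var 8) refl) ,
  (c + v₂ + w₁ - u₃ , pair (vecᴱ (Κ 0ℤ) (Κ (+ 1)) (Κ 0ℤ)) (var 0 ⊕ᴱ var 5 ⊕ᴱ var 7 ⊕ᴱ ⊝ᴱ var 3) refl) ,
  (c + w₃ + u₂ - v₁ , pair (vecᴱ (Κ 0ℤ) (Κ 0ℤ) (Κ (+ 1))) (var 0 ⊕ᴱ var 9 ⊕ᴱ var 2 ⊕ᴱ ⊝ᴱ var 4) refl)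
  where
  ρ : Vec ℤ 10
  ρ = c ∷ u₁ ∷ u₂ ∷ u₃ ∷ v₁ ∷ v₂ ∷ v₃ ∷ w₁ ∷ w₂ ∷ w₃ ∷ []
  form-at : Z3ᴱ 10 → Expr ℤ 10
  form-at t = S.form (var 0) (vecᴱ (var 1) (var 2) (var 3)) (vecᴱ (var 4) (var 5) (var 6))
                     (vecᴱ (var 7) (var 8) (var 9)) (S.quat (Κ (+ 1)) t)
  pair : ∀ t h → Ops.⟦ form-at t ⇓⟧ ρ ≡ Ops.⟦ Κ (+ 2) ⊗ᴱ h ⇓⟧ ρ → Ops.⟦ form-at t ⟧ ρ ≡ Ops.⟦ Κ (+ 2) ⊗ᴱ h ⟧ ρ
  pair t h = ℤ-identity ρ (form-at t) (Κ (+ 2) ⊗ᴱ h)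

HurwitzParity : Q → Set
HurwitzParity (quat a (vec b c d)) = (Even a × Even b × Even c × Even d) ⊎ (Odd a × Odd b × Odd c × Odd d)

toHurwitz : (α : Q) → HurwitzParity α → Hurwitz
toHurwitz (quat a (vec b c d)) p = hurwitz a b c d p

HurwitzParity-from-even-sums : ∀ {a b c d} → Even (a + b) → Even (a + c) → Even (a + d) →
                               HurwitzParity (quat a (vec b c d))
HurwitzParity-from-even-sums ab ac ad with even⊎odd _
... | inj₁ a-even = inj₁ (a-even , a+b-even∧a-even⇒b-even ab a-even ,
                          a+b-even∧a-even⇒b-even ac a-even , a+b-even∧a-even⇒b-even ad a-even)
... | inj₂ a-odd  = inj₂ (a-odd , a+b-even∧a-odd⇒b-odd ab a-odd ,
                          a+b-even∧a-odd⇒b-odd ac a-odd , a+b-even∧a-odd⇒b-odd ad a-odd)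

⟪⟫-even : ∀ s {a₀ a₁ a₂ a₃} → Even a₀ → Even a₁ → Even a₂ → Even a₃ → Even ⟪ s , quat a₀ (vec a₁ a₂ a₃) ⟫
⟪⟫-even s {a₀} {a₁} {a₂} {a₃} (t₀ , a₀≡2t₀) (t₁ , a₁≡2t₁) (t₂ , a₂≡2t₂) (t₃ , a₃≡2t₃) = ⟪ s , τ ⟫ , (begin
  ⟪ s , quat a₀ (vec a₁ a₂ a₃) ⟫  ≡⟨ cong ⟪ s ,_⟫ (cong₂ quat a₀≡2t₀ (cong₃ vec a₁≡2t₁ a₂≡2t₂ a₃≡2t₃)) ⟩
  ⟪ s , (+ 2) ⊙ τ ⟫               ≡⟨ ⟪⟫-⊙ s (+ 2) τ ⟩
  + 2 * ⟪ s , τ ⟫                 ∎)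
  where
  τ : Q
  τ = quat t₀ (vec t₁ t₂ t₃)

HurwitzSolution : Z3 → Z3 → Set
HurwitzSolution v w = ∃ λ (α : Hurwitz) → ∃ λ (d : ℤ) → LastTwoCols d α v w ⊎ LastTwoCols d α (neg w) v

hurwitz-last-columns : ∀ L d γ v w → L ≢ 0ℤ → (p : HurwitzParity γ) →
  L ⊛ E₂ γ ≡ norm γ ⊛ v → L ⊛ E₃ γ ≡ norm γ ⊛ w → + 4 * L ≡ d * norm γ →
  LastTwoCols d (toHurwitz γ p) v w
hurwitz-last-columns L d γ@(quat _ (vec _ _ _)) v w L≢0 p col₂ col₃ 4L≡dN =
  column-rescale L (norm γ) (+ 4) d (E₂ γ) v L≢0 col₂ 4L≡dN ,
  column-rescale L (norm γ) (+ 4) d (E₃ γ) w L≢0 col₃ 4L≡dN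

-- E(α(1 − i)) = E(α)·E(1 − i), and E(1 − i) is twice a quarter turn about the first axis.
⊗[𝟏-𝐢]-coordinates : ∀ a₀ a₁ a₂ a₃ →
  quat a₀ (vec a₁ a₂ a₃) ⊗ (𝟏 ⊟ 𝐢) ≡ quat (a₀ + a₁) (vec (a₁ - a₀) (a₂ - a₃) (a₂ + a₃))
⊗[𝟏-𝐢]-coordinates a₀ a₁ a₂ a₃ =
  Q-identity (a₀ ∷ a₁ ∷ a₂ ∷ a₃ ∷ []) (α S.⊗ (S.𝟏 S.⊟ S.𝐢))
    (quatᴱ (var 0 ⊕ᴱ var 1) (var 1 ⊕ᴱ ⊝ᴱ var 0) (var 2 ⊕ᴱ ⊝ᴱ var 3) (var 2 ⊕ᴱ var 3)) refl refl refl refl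
  where
  α : S.Quaternion
  α = quatᴱ (var 0) (var 1) (var 2) (var 3)

E₂-⊗[𝟏-𝐢] : ∀ α → E₂ (α ⊗ (𝟏 ⊟ 𝐢)) ≡ (- + 2) ⊛ E₃ α
E₂-⊗[𝟏-𝐢] (quat a₀ (vec a₁ a₂ a₃)) =
  Z3-identity (a₀ ∷ a₁ ∷ a₂ ∷ a₃ ∷ []) (S.E₂ (α S.⊗ (S.𝟏 S.⊟ S.𝐢))) ((⊝ᴱ Κ (+ 2)) S.⊛ S.E₃ α) refl refl refl
  where
  α : S.Quaternion
  α = quatᴱ (var 0) (var 1) (var 2) (var 3)

E₃-⊗[𝟏-𝐢] : ∀ α → E₃ (α ⊗ (𝟏 ⊟ 𝐢)) ≡ (+ 2) ⊛ E₂ α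
E₃-⊗[𝟏-𝐢] (quat a₀ (vec a₁ a₂ a₃)) =
  Z3-identity (a₀ ∷ a₁ ∷ a₂ ∷ a₃ ∷ []) (S.E₃ (α S.⊗ (S.𝟏 S.⊟ S.𝐢))) (Κ (+ 2) S.⊛ S.E₂ α) refl refl refl
  where
  α : S.Quaternion
  α = quatᴱ (var 0) (var 1) (var 2) (var 3)

norm-⊗[𝟏-𝐢] : ∀ α → norm (α ⊗ (𝟏 ⊟ 𝐢)) ≡ + 2 * norm α
norm-⊗[𝟏-𝐢] (quat a₀ (vec a₁ a₂ a₃)) =
  ℤ-identity (a₀ ∷ a₁ ∷ a₂ ∷ a₃ ∷ []) (S.norm (α S.⊗ (S.𝟏 S.⊟ S.𝐢))) (Κ (+ 2) ⊗ᴱ S.norm α) refl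
  where
  α : S.Quaternion
  α = quatᴱ (var 0) (var 1) (var 2) (var 3)

-2⊛≡2⊛neg : ∀ w → (- + 2) ⊛ w ≡ (+ 2) ⊛ neg w
-2⊛≡2⊛neg (vec w₁ w₂ w₃) =
  Z3-identity (w₁ ∷ w₂ ∷ w₃ ∷ []) ((⊝ᴱ Κ (+ 2)) S.⊛ w) (Κ (+ 2) S.⊛ S.neg w) refl refl refl
  where
  w : Z3ᴱ 3
  w = vecᴱ (var 0) (var 1) (var 2)

norm-even⇒HurwitzParity-⊗[𝟏-𝐢] : ∀ α → Even (norm α) → HurwitzParity (α ⊗ (𝟏 ⊟ 𝐢))
norm-even⇒HurwitzParity-⊗[𝟏-𝐢] (quat a₀ (vec a₁ a₂ a₃)) N-even =
  subst HurwitzParity (sym (⊗[𝟏-𝐢]-coordinates a₀ a₁ a₂ a₃))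
    (HurwitzParity-from-even-sums [a₀+a₁]+[a₁-a₀] [a₀+a₁]+[a₂-a₃] [a₀+a₁]+[a₂+a₃])
  where
  N : ℤ
  N = norm (quat a₀ (vec a₁ a₂ a₃))
  ρ : Vec ℤ 4
  ρ = a₀ ∷ a₁ ∷ a₂ ∷ a₃ ∷ []
  αᴱ : S.Quaternion {4}
  αᴱ = quatᴱ (var 0) (var 1) (var 2) (var 3)
  [a₀+a₁]+[a₂+a₃] : Even ((a₀ + a₁) + (a₂ + a₃))
  [a₀+a₁]+[a₂+a₃] = m*m-even⇒m-even (square-even N-even)
    where
    cross-terms : ℤ
    cross-terms = a₀ * a₁ + a₂ * a₃ + (a₀ + a₁) * (a₂ + a₃)
    square≡N+2c : (a₀ + a₁ + (a₂ + a₃)) * (a₀ + a₁ + (a₂ + a₃)) ≡ N + + 2 * cross-terms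
    square≡N+2c = ℤ-identity ρ ((t ⊕ᴱ r) ⊗ᴱ (t ⊕ᴱ r))
      (S.norm αᴱ ⊕ᴱ Κ (+ 2) ⊗ᴱ (var 0 ⊗ᴱ var 1 ⊕ᴱ var 2 ⊗ᴱ var 3 ⊕ᴱ t ⊗ᴱ r)) refl
      where
      t r : Expr ℤ 4
      t = var 0 ⊕ᴱ var 1
      r = var 2 ⊕ᴱ var 3
    square-even : Even N → Even ((a₀ + a₁ + (a₂ + a₃)) * (a₀ + a₁ + (a₂ + a₃)))
    square-even (q , N≡2q) = q + cross-terms , (begin
      (a₀ + a₁ + (a₂ + a₃)) * (a₀ + a₁ + (a₂ + a₃))   ≡⟨ square≡N+2c ⟩
      N + + 2 * cross-terms                           ≡⟨ cong (_+ + 2 * cross-terms) N≡2q ⟩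
      + 2 * q + + 2 * cross-terms                     ≡⟨ ℤ.*-distribˡ-+ (+ 2) q cross-terms ⟨
      + 2 * (q + cross-terms)                         ∎)
  [a₀+a₁]+[a₁-a₀] : Even ((a₀ + a₁) + (a₁ - a₀))
  [a₀+a₁]+[a₁-a₀] = a₁ , twice a₀ a₁
    where
    twice : ∀ a₀ a₁ → a₀ + a₁ + (a₁ - a₀) ≡ + 2 * a₁
    twice = ℤ-Solver.solve-∀
  [a₀+a₁]+[a₂-a₃] : Even ((a₀ + a₁) + (a₂ - a₃))
  [a₀+a₁]+[a₂-a₃] = shift [a₀+a₁]+[a₂+a₃]
    where
    regroup : ∀ a₀ a₁ a₂ a₃ → a₀ + a₁ + (a₂ - a₃) ≡ a₀ + a₁ + (a₂ + a₃) - + 2 * a₃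
    regroup = ℤ-Solver.solve-∀
    factor : ∀ r a₃ → + 2 * r - + 2 * a₃ ≡ + 2 * (r - a₃)
    factor = ℤ-Solver.solve-∀
    shift : Even ((a₀ + a₁) + (a₂ + a₃)) → Even ((a₀ + a₁) + (a₂ - a₃))
    shift (r , [a₀+a₁]+[a₂+a₃]≡2r) = r - a₃ , (begin
      a₀ + a₁ + (a₂ - a₃)             ≡⟨ regroup a₀ a₁ a₂ a₃ ⟩
      a₀ + a₁ + (a₂ + a₃) - + 2 * a₃  ≡⟨ cong (_- + 2 * a₃) [a₀+a₁]+[a₂+a₃]≡2r ⟩
      + 2 * r - + 2 * a₃              ≡⟨ factor r a₃ ⟩
      + 2 * (r - a₃)                  ∎)

module _ {L : ℤ} {u v w : Z3} {a₀ a₁ a₂ a₃ : ℤ} (L≢0 : L ≢ 0ℤ)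
         (R : Represents L (quat a₀ (vec a₁ a₂ a₃)) u v w) (s : Q) (⟪s,α⟫≡1 : ⟪ s , quat a₀ (vec a₁ a₂ a₃) ⟫ ≡ + 1) where

  private
    α : Q
    α = quat a₀ (vec a₁ a₂ a₃)
    N K : ℤ
    N = norm α
    K = form L u v w s
    col₂ : L ⊛ E₂ α ≡ N ⊛ v
    col₂ = proj₁ (proj₂ R)
    col₃ : L ⊛ E₃ α ≡ N ⊛ w
    col₃ = proj₂ (proj₂ R)
    αᴱ : S.Quaternion {4}
    αᴱ = quatᴱ (var 0) (var 1) (var 2) (var 3)
    ρ : Vec ℤ 4
    ρ = a₀ ∷ a₁ ∷ a₂ ∷ a₃ ∷ []

    N*K≡4L : N * K ≡ + 4 * L
    N*K≡4L = begin
      N * K                              ≡⟨ norm*form L α u v w R s ⟩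
      + 4 * L * (⟪ s , α ⟫ * ⟪ s , α ⟫)  ≡⟨ cong (λ t → + 4 * L * (t * t)) ⟪s,α⟫≡1 ⟩
      + 4 * L * + 1                      ≡⟨ ℤ.*-identityʳ (+ 4 * L) ⟩
      + 4 * L                            ∎

    N≢0 : N ≢ 0ℤ
    N≢0 N≡0 = L≢0 (*-cancelˡ {k = + 4} (λ ()) (begin
      + 4 * L      ≡⟨ N*K≡4L ⟨
      N * K        ≡⟨ cong (_* K) N≡0 ⟩
      0ℤ           ≡⟨ ℤ.*-zeroʳ (+ 4) ⟨
      + 4 * 0ℤ     ∎))

    form≡K*square : ∀ t → form L u v w t ≡ K * (⟪ t , α ⟫ * ⟪ t , α ⟫)
    form≡K*square t = *-cancelˡ N≢0 (begin
      N * form L u v w t                 ≡⟨ norm*form L α u v w R t ⟩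
      + 4 * L * (⟪ t , α ⟫ * ⟪ t , α ⟫)  ≡⟨ cong (_* (⟪ t , α ⟫ * ⟪ t , α ⟫)) N*K≡4L ⟨
      N * K * (⟪ t , α ⟫ * ⟪ t , α ⟫)    ≡⟨ ℤ.*-assoc N K _ ⟩
      N * (K * (⟪ t , α ⟫ * ⟪ t , α ⟫))  ∎)

    odd-cofactor : Odd K → HurwitzSolution v w
    odd-cofactor K-odd = toHurwitz α all-odd , K ,
      inj₁ (hurwitz-last-columns L K α v w L≢0 all-odd col₂ col₃ (trans (sym N*K≡4L) (ℤ.*-comm N K)))
      where
      a₀+aᵢ-even : ∀ t aᵢ → ⟪ t , α ⟫ ≡ a₀ + aᵢ → Even (form L u v w t) → Even (a₀ + aᵢ)
      a₀+aᵢ-even t aᵢ ⟪t,α⟫≡a₀+aᵢ form-even = subst Even ⟪t,α⟫≡a₀+aᵢ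
        (m*m-even⇒m-even (odd*m-even⇒m-even K-odd (subst Even (form≡K*square t) form-even)))
      a₀+a₁ : Even (a₀ + a₁)
      a₀+a₁ = a₀+aᵢ-even (quat (+ 1) (vec (+ 1) 0ℤ 0ℤ)) a₁
        (ℤ-identity ρ (S.⟪ quatᴱ (Κ (+ 1)) (Κ (+ 1)) (Κ 0ℤ) (Κ 0ℤ) , αᴱ ⟫) (var 0 ⊕ᴱ var 1) refl) (proj₁ (form-pairs-even L u v w))
      a₀+a₂ : Even (a₀ + a₂)
      a₀+a₂ = a₀+aᵢ-even (quat (+ 1) (vec 0ℤ (+ 1) 0ℤ)) a₂
        (ℤ-identity ρ (S.⟪ quatᴱ (Κ (+ 1)) (Κ 0ℤ) (Κ (+ 1)) (Κ 0ℤ) , αᴱ ⟫) (var 0 ⊕ᴱ var 2) refl) (proj₁ (proj₂ (form-pairs-even L u v w)))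
      a₀+a₃ : Even (a₀ + a₃)
      a₀+a₃ = a₀+aᵢ-even (quat (+ 1) (vec 0ℤ 0ℤ (+ 1))) a₃
        (ℤ-identity ρ (S.⟪ quatᴱ (Κ (+ 1)) (Κ 0ℤ) (Κ 0ℤ) (Κ (+ 1)) , αᴱ ⟫) (var 0 ⊕ᴱ var 3) refl) (proj₂ (proj₂ (form-pairs-even L u v w)))
      all-odd : HurwitzParity α
      all-odd with HurwitzParity-from-even-sums a₀+a₁ a₀+a₂ a₀+a₃
      ... | inj₁ (e₀ , e₁ , e₂ , e₃) = ⊥-elim (even∧odd⇒⊥ (subst Even ⟪s,α⟫≡1 (⟪⟫-even s e₀ e₁ e₂ e₃)) (0ℤ , refl))
      ... | inj₂ odd = inj₂ odd

    cofactor≡0-mod-4 : ∀ d → K ≡ + 2 * (+ 2 * d) → HurwitzSolution v w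
    cofactor≡0-mod-4 d K≡4d = toHurwitz γ all-even , d ,
      inj₁ (hurwitz-last-columns L d γ v w L≢0 all-even
              (column-transport L {E₂ α} {E₂ γ} {N} {norm γ} (+ 2 * + 2) (+ 2 * + 2) v v
                 (E₂-⊙ (+ 2) α) (norm-⊙ (+ 2) α) refl col₂)
              (column-transport L {E₃ α} {E₃ γ} {N} {norm γ} (+ 2 * + 2) (+ 2 * + 2) w w
                 (E₃-⊙ (+ 2) α) (norm-⊙ (+ 2) α) refl col₃)
              4L≡d*normγ)
      where
      γ : Q
      γ = (+ 2) ⊙ α
      all-even : HurwitzParity γ
      all-even = inj₁ ((a₀ , refl) , (a₁ , refl) , (a₂ , refl) , (a₃ , refl))
      regroup : ∀ N d → N * (+ 2 * (+ 2 * d)) ≡ d * (+ 2 * + 2 * N)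
      regroup = ℤ-Solver.solve-∀
      4L≡d*normγ : + 4 * L ≡ d * norm γ
      4L≡d*normγ = begin
        + 4 * L                 ≡⟨ N*K≡4L ⟨
        N * K                   ≡⟨ cong (N *_) K≡4d ⟩
        N * (+ 2 * (+ 2 * d))   ≡⟨ regroup N d ⟩
        d * (+ 2 * + 2 * N)     ≡⟨ cong (d *_) (norm-⊙ (+ 2) α) ⟨
        d * norm γ              ∎

    cofactor≡2-mod-4 : ∀ d → K ≡ + 2 * (+ 2 * d + + 1) → HurwitzSolution v w
    cofactor≡2-mod-4 d K≡2m = toHurwitz γ γ-parity , m ,
      inj₂ (hurwitz-last-columns L m γ (neg w) v L≢0 γ-parity
              (column-transport L {E₃ α} {E₂ γ} {N} {norm γ} (- + 2) (+ 2) w (neg w)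
                 (E₂-⊗[𝟏-𝐢] α) (norm-⊗[𝟏-𝐢] α) (-2⊛≡2⊛neg w) col₃)
              (column-transport L {E₂ α} {E₃ γ} {N} {norm γ} (+ 2) (+ 2) v v
                 (E₃-⊗[𝟏-𝐢] α) (norm-⊗[𝟏-𝐢] α) refl col₂)
              (trans 4L≡m[2N] (cong (m *_) (sym (norm-⊗[𝟏-𝐢] α)))))
      where
      m : ℤ
      m = + 2 * d + + 1
      γ : Q
      γ = α ⊗ (𝟏 ⊟ 𝐢)
      4L≡m[2N] : + 4 * L ≡ m * (+ 2 * N)
      4L≡m[2N] = begin
        + 4 * L         ≡⟨ N*K≡4L ⟨
        N * K           ≡⟨ cong (N *_) K≡2m ⟩
        N * (+ 2 * m)   ≡⟨ regroup N m ⟩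
        m * (+ 2 * N)   ∎
        where
        regroup : ∀ N m → N * (+ 2 * m) ≡ m * (+ 2 * N)
        regroup = ℤ-Solver.solve-∀
      N-even : Even N
      N-even = odd*m-even⇒m-even (d , refl) (L , *-cancelˡ {k = + 2} (λ ()) (begin
        + 2 * (m * N)     ≡⟨ regroup m N ⟩
        m * (+ 2 * N)     ≡⟨ 4L≡m[2N] ⟨
        + 4 * L           ≡⟨ regroup′ L ⟩
        + 2 * (+ 2 * L)   ∎))
        where
        regroup : ∀ m N → + 2 * (m * N) ≡ m * (+ 2 * N)
        regroup = ℤ-Solver.solve-∀
        regroup′ : ∀ L → + 4 * L ≡ + 2 * (+ 2 * L)
        regroup′ = ℤ-Solver.solve-∀
      γ-parity : HurwitzParity γ
      γ-parity = norm-even⇒HurwitzParity-⊗[𝟏-𝐢] α N-even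

  primitive-represented-hurwitz : HurwitzSolution v w
  primitive-represented-hurwitz with even⊎odd K
  ... | inj₂ K-odd = odd-cofactor K-odd
  ... | inj₁ (K′ , K≡2K′) with even⊎odd K′
  ...   | inj₁ (d , K′≡2d)   = cofactor≡0-mod-4 d (trans K≡2K′ (cong (+ 2 *_) K′≡2d))
  ...   | inj₂ (d , K′≡2d+1) = cofactor≡2-mod-4 d (trans K≡2K′ (cong (+ 2 *_) K′≡2d+1))

frame-hurwitz : ∀ {L u v w} → L ≢ 0ℤ → Frame L u v w → HurwitzSolution v w
frame-hurwitz {L} {u} {v} {w} L≢0 F = from-nonzero (frame-quaternion-nonzero u v w L≢0)
  where
  from-nonzero : ∃ (λ x → frame-quaternion L u v w x ≢ 0q) → HurwitzSolution v w
  from-nonzero (x , β≢0) = from-primitive (primitive-part (frame-quaternion L u v w x) β≢0)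
    where
    from-primitive : ∃ (λ g → ∃ λ α → g ≢ 0ℤ × frame-quaternion L u v w x ≡ g ⊙ α × Primitive α) →
                     HurwitzSolution v w
    from-primitive (g , α , g≢0 , β≡gα , s , ⟪s,α⟫≡1) =
      primitive-represented-hurwitz L≢0
        (represents-descale {L} {u} {v} {w} α g g≢0 (subst (λ β → Represents L β u v w) β≡gα (frame-represents F x)))
        s ⟪s,α⟫≡1

corollary5p11 : (v w : Z3) → Twins v w → (∃ λ (L : ℤ) → v · v ≡ L * L) →
    (∃ λ (α : Hurwitz) → ∃ λ (d : ℤ) →
      LastTwoCols d α v w ⊎ LastTwoCols d α (neg w) v)
    × (∃ λ (u : Z3) → Icube u v w)
corollary5p11 v w (v≢0 , _ , v·w≡0 , v·v≡w·w) (L , v·v≡L²) =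
  frame-hurwitz L≢0 (proj₂ completion) , proj₁ completion , frame-icube L≢0 (proj₂ completion)
  where
  L≢0 : L ≢ 0ℤ
  L≢0 refl = v≢0 (v·v≡0⇒v≡0 v v·v≡L²)
  completion : ∃ λ u → Frame L u v w
  completion = twins-frame L≢0 v·v≡L² (trans (sym v·v≡w·w) v·v≡L²) v·w≡0
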